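{- Given a connected chordal graph $G=([n],E)$ in perfect elimination order, Algorithm A (described in the context) visits each acyclic orientation of $G$ in time $\mathcal{O}(\log\omega)$ on average, where $\omega=\omega(G)$ is the clique number of $G$.
   Context: Graphs are finite and simple; $[n]=\{1,\ldots,n\}$. A graph is chordal if every induced cycle has length 3. $G_i$ (resp. $D_i$) denotes the subgraph (subdigraph) induced by $[i]$. $G=([n],E)$ is in perfect elimination order if for every $i\in[n]$ the neighborhood of $i$ in $G_i$ is a clique. $N_i$ denotes the set of neighbors of $i$ in $G_i$. An acyclic orientation of $G$ is an orientation of all edges of $G$ without directed cycles; an arc flip reverses the direction of a single arc. The transitive reduction of an acyclic orientation of a clique is a directed path $v_1\to v_2\to\cdots\to v_k$ (the total order given by the orientation). "On average" refers to the total time spent after the initialization step A1, divided by the number of acyclic orientations visited. Reading or writing an entry of an array or matrix takes constant time, and so does a visit. Algorithm A. Given a connected chordal graph $G=([n],E)$ in perfect elimination order, the algorithm generates all acyclic orientations of $G$ by arc flips. It maintains the current acyclic orientation $D=([n],A)$ of $G$ as an adjacency matrix $A=(a_{i,j})_{i,j\in[n]}$, with $a_{i,j}\in\{0,1\}$ and $a_{i,j}=1$ iff the arc $i\to j$ is present in $D$; total orderings $T_j=(T_{j,1},\ldots,T_{j,|N_j|})$ of $N_j$ and an index $t_j$, $0\le t_j\le|N_j|$, into $T_j$ for $j=1,\ldots,n$; and auxiliary arrays $o=(o_1,\ldots,o_n)$ with entries in $\{\mathrm{L},\mathrm{R}\}$ and $s=(s_1,\ldots,s_n)$. A1 [Initialize].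 For $i,j=1,\ldots,n$ set $a_{i,j}\gets0$. Then for $j=1,\ldots,n$ and all $i\in N_j$ set $a_{i,j}\gets1$. Also set $t_j\gets0$, $o_j\gets\mathrm{L}$, $s_j\gets j$ for $j=1,\ldots,n$. A2 [Visit]. Visit the current acyclic orientation $D$. A3 [Select vertex]. Set $j\gets s_n$, and terminate if $j=1$. A4 [Sort neighbors]. If $t_j=0$, compute the transitive reduction $v_1\to v_2\to\cdots\to v_k$ of the clique in $D_j$ formed by the vertices in $N_j$ via sorting, using the matrix entries $a_{i,i'}$, $i,i'\in N_j$, for comparisons (sorting $d$ elements takes time $\mathcal{O}(d\log d)$). If $o_j=\mathrm{L}$ set $T_j\gets(v_k,v_{k-1},\ldots,v_1)$, and if $o_j=\mathrm{R}$ set $T_j\gets(v_1,v_2,\ldots,v_k)$. A5 [Flip arc]. Set $t_j\gets t_j+1$. In $D$, flip the arc between $j$ and $i\gets T_{j,t_j}$: if $o_j=\mathrm{L}$ set $a_{i,j}\gets0$ and $a_{j,i}\gets1$; if $o_j=\mathrm{R}$ set $a_{i,j}\gets1$ and $a_{j,i}\gets0$. A6 [Update $o$ and $s$]. Set $s_n\gets n$. If $t_j=|N_j|$: if $o_j=\mathrm{L}$ ($j$ has become a source in $D_j$) set $o_j\gets\mathrm{R}$, and if $o_j=\mathrm{R}$ ($j$ has become a sink in $D_j$) set $o_j\gets\mathrm{L}$, and in both cases set $t_j\gets0$, then $s_j\gets s_{j-1}$, then $s_{j-1}\gets j-1$. Go back to A2. -}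

module Defs where

open import Data.Bool using (Bool; true; false; if_then_else_)
open import Data.Fin using (Fin; zero; suc; toℕ; fromℕ; inject₁; _<_)
open import Data.Fin.Properties using (_<?_)
open import Data.Fin.Subset using (Subset; ∣_∣; _∈_)
open import Data.List using (List; []; _∷_; allFin; drop; filter; head; length; reverse)
import Data.List.Membership.Propositional as List
open import Data.List.Relation.Binary.Permutation.Propositional using (_↭_)
open import Data.List.Relation.Unary.AllPairs using (AllPairs)
open import Data.List.Relation.Unary.Unique.Propositional using (Unique)
open import Data.Maybe using (Maybe; just; nothing)
open import Data.Nat using (ℕ; suc; pred; _+_; _*_; _≤_; _≡ᵇ_)
open import Data.Nat.Logarithm using (⌊log₂_⌋)
open import Data.Product using (_×_; _,_; ∃-syntax)
open import Data.Sum using (_⊎_)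
open import Data.Unit using (⊤; tt)
open import Data.Vec using (Vec; lookup; replicate; tabulate; _[_]≔_; _[_]%=_)
import Data.Vec as Vec
open import Function using (_⇔_)
open import Function.Definitions using (Injective)
open import Level using (0ℓ)
open import Relation.Binary using (Rel; Irreflexive; Symmetric; Decidable; Tri)
open import Relation.Binary.Construct.Closure.ReflexiveTransitive using (Star)
open import Relation.Binary.Construct.Closure.Transitive using (TransClosure)
open import Relation.Binary.PropositionalEquality using (_≡_; _≢_)
open import Relation.Nullary using (¬_; does)
open import Relation.Nullary.Decidable using (_×-dec_)
import Relation.Unary as Unary

-- The vertices 1, …, n are represented by the elements 0, …, n - 1 of Fin n.

record Graph (n : ℕ) : Set₁ where
  infix 4 _~_ _~?_
  field
    _~_      : Rel (Fin n) 0ℓ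
    _~?_     : Decidable _~_
    ~-sym    : Symmetric _~_
    ~-irrefl : Irreflexive _≡_ _~_

module _ {n : ℕ} (G : Graph n) where
  open Graph G

  Connected : Set
  Connected = ∀ u v → Star _~_ u v

  IsClique : Unary.Pred (Fin n) 0ℓ → Set
  IsClique P = ∀ {u v} → P u → P v → u ≢ v → u ~ v

  CyclicSuccessor : ∀ {k} → Rel (Fin k) 0ℓ
  CyclicSuccessor {k} i j = suc (toℕ i) ≡ toℕ j ⊎ (suc (toℕ i) ≡ k × toℕ j ≡ 0)

  record InducedCycle (k : ℕ) : Set where
    field
      k≥3       : 3 ≤ k
      vertex    : Fin k → Fin n
      injective : Injective _≡_ _≡_ vertex
      induced   : ∀ i j → vertex i ~ vertex j ⇔ (CyclicSuccessor i j ⊎ CyclicSuccessor j i)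

  Chordal : Set
  Chordal = ∀ {k} → InducedCycle k → k ≡ 3

  -- i is a neighbour of j in the subgraph induced by the vertices up to j.
  EarlierNeighbour : Fin n → Fin n → Set
  EarlierNeighbour j i = i < j × i ~ j

  earlierNeighbour? : ∀ j → Unary.Decidable (EarlierNeighbour j)
  earlierNeighbour? j i = (i <? j) ×-dec (i ~? j)

  PerfectEliminationOrder : Set
  PerfectEliminationOrder = ∀ j → IsClique (EarlierNeighbour j)

  earlierNeighbours : Fin n → List (Fin n)
  earlierNeighbours j = filter (earlierNeighbour? j) (allFin n)

  IsCliqueNumber : ℕ → Set
  IsCliqueNumber ω =
    (∃[ S ] (IsClique (_∈ S) × ∣ S ∣ ≡ ω)) ×
    (∀ (S : Subset n) → IsClique (_∈ S) → ∣ S ∣ ≤ ω)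

Matrix : ℕ → Set
Matrix n = Vec (Vec Bool n) n

entry : ∀ {n} → Matrix n → Fin n → Fin n → Bool
entry a i j = lookup (lookup a i) j

Arc : ∀ {n} → Matrix n → Rel (Fin n) 0ℓ
Arc a i j = entry a i j ≡ true

record IsAcyclicOrientation {n : ℕ} (G : Graph n) (a : Matrix n) : Set where
  open Graph G
  field
    arc⇒edge : ∀ {i j} → Arc a i j → i ~ j
    edge⇒arc : ∀ {i j} → i ~ j → Arc a i j ⊎ Arc a j i
    one-way  : ∀ {i j} → Arc a i j → ¬ Arc a j i
    acyclic  : Irreflexive _≡_ (TransClosure (Arc a))

-- Cost model: each access to an array or matrix entry, each arithmetic
-- operation, each test and each visit takes one unit of time.

infix 4 _after_

record Timed (A : Set) : Set where
  constructor _after_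
  field
    value : A
    time  : ℕ

open Timed public

record StrictTotalOn {A : Set} (_≺_ : Rel A 0ℓ) (xs : List A) : Set where
  field
    trans   : ∀ {x y z} → x List.∈ xs → y List.∈ xs → z List.∈ xs →
              x ≺ y → y ≺ z → x ≺ z
    compare : ∀ {x y} → x List.∈ xs → y List.∈ xs → Tri (x ≺ y) (x ≡ y) (y ≺ x)

-- An arbitrary comparison sort running in time O(d log d) on lists of length
-- d. The summand 1 in the bound only matters for d ≤ 1, where d log d = 0.
record SortingAlgorithm : Set₁ where
  field
    sort     : ∀ {A : Set} → (A → A → Timed Bool) → List A → Timed (List A)
    constant : ℕ
    sorts    : ∀ {A : Set} (less : A → A → Timed Bool) (xs : List A) → Unique xs →
               StrictTotalOn (λ x y → value (less x y) ≡ true) xs →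
               value (sort less xs) ↭ xs ×
               AllPairs (λ x y → value (less x y) ≡ true) (value (sort less xs))
    fast     : ∀ {A : Set} (less : A → A → Timed Bool) (xs : List A) →
               (∀ x y → time (less x y) ≤ 1) →
               time (sort less xs) ≤ constant * (1 + length xs * ⌊log₂ length xs ⌋)

data Side : Set where
  L R : Side

record Store (n : ℕ) : Set where
  field
    a : Matrix n
    T : Vec (List (Fin n)) n
    t : Vec ℕ n
    o : Vec Side n
    s : Vec (Fin n) n

open Store public

-- The algorithm does not initialise the orderings T_j; they are empty here,
-- and reading a missing entry makes the algorithm fail.
initial : ∀ {n} → Graph n → Store n
initial {n} G = record
  { a = tabulate λ i → tabulate λ j → does (earlierNeighbour? G j i)
  ; T = replicate n []
  ; t = replicate n 0
  ; o = replicate n L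
  ; s = Vec.allFin n
  }

Program : ℕ → Set → Set
Program n A = Store n → Timed (A × Store n)

module _ {n : ℕ} where

  infixl 1 _>>=_ _>>_

  return : ∀ {A} → A → Program n A
  return x σ = (x , σ) after 0

  _>>=_ : ∀ {A B} → Program n A → (A → Program n B) → Program n B
  (p >>= f) σ with p σ
  ... | (x , σ′) after τ with f x σ′
  ...   | r after τ′ = r after (τ + τ′)

  _>>_ : ∀ {A B} → Program n A → Program n B → Program n B
  p >> q = p >>= λ _ → q

  spend : ℕ → Program n ⊤
  spend τ σ = (tt , σ) after τ

  tick : Program n ⊤
  tick = spend 1

  read : ∀ {A} → (Store n → Vec A n) → Fin n → Program n A
  read array j σ = (lookup (array σ) j , σ) after 1

  -- The argument k counts from 1, as in T_{j,k}.
  readT : Fin n → ℕ → Program n (Maybe (Fin n))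
  readT j k σ = (head (drop (pred k) (lookup (T σ) j)) , σ) after 1

  writeA : Fin n → Fin n → Bool → Program n ⊤
  writeA i j b σ = (tt , record σ { a = a σ [ i ]%= (_[ j ]≔ b) }) after 1

  writeT : Fin n → List (Fin n) → Program n ⊤
  writeT j vs σ = (tt , record σ { T = T σ [ j ]≔ vs }) after length vs

  write-t : Fin n → ℕ → Program n ⊤
  write-t j k σ = (tt , record σ { t = t σ [ j ]≔ k }) after 1

  write-o : Fin n → Side → Program n ⊤
  write-o j x σ = (tt , record σ { o = o σ [ j ]≔ x }) after 1

  write-s : Fin n → Fin n → Program n ⊤
  write-s j i σ = (tt , record σ { s = s σ [ j ]≔ i }) after 1

data Signal : Set where
  terminate go-back fail : Signal

module AlgorithmA (S : SortingAlgorithm) {m : ℕ} (G : Graph (suc m)) where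
  open SortingAlgorithm S

  private
    n = suc m

  last : Fin n
  last = fromℕ m

  N : Fin n → List (Fin n)
  N = earlierNeighbours G

  -- The lists N_j and their lengths are part of the input: reading the list
  -- costs one unit per element, reading the length costs one unit.
  readN : Fin n → Program n (List (Fin n))
  readN j = do
    spend (length (N j))
    return (N j)

  degree : Fin n → Program n ℕ
  degree j = do
    tick
    return (length (N j))

  sortByArcs : List (Fin n) → Program n (List (Fin n))
  sortByArcs us σ with sort (λ u v → entry (a σ) u v after 1) us
  ... | vs after τ = (vs , σ) after τ

  -- Sorting by arcs yields v₁ → ⋯ → v_k, the transitive reduction of the clique.
  sortNeighbours : Fin n → Program n ⊤
  sortNeighbours j = do
    k ← read t j
    tick
    if k ≡ᵇ 0
      then (do
        us ← readN j
        vs ← sortByArcs us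
        L ← read o j
          where R → do
                  tick
                  writeT j vs
        tick
        writeT j (reverse vs))
      else return tt

  flipArc : Fin n → Program n Signal
  flipArc j = do
    k ← read t j
    tick
    write-t j (suc k)
    just i ← readT j (suc k)
      where nothing → return fail
    L ← read o j
      where R → do
              tick
              writeA i j true
              writeA j i false
              return go-back
    tick
    writeA i j false
    writeA j i true
    return go-back

  turn : Fin n → Program n ⊤
  turn j = do
    L ← read o j
      where R → do
              tick
              write-o j L
    tick
    write-o j R

  update : Fin n → Fin n → Program n ⊤
  update j j-1 = do
    write-s last last
    k ← read t j
    d ← degree j
    tick
    if k ≡ᵇ d
      then (do
        turn j
        write-t j 0
        i ← read s j-1
        write-s j i
        write-s j-1 j-1)
      else return tt

  process : Fin n → Program n Signal
  process zero    = return terminate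
  process (suc i) = do
    sortNeighbours (suc i)
    go-back ← flipArc (suc i)
      where signal → return signal
    tick
    update (suc i) (inject₁ i)
    return go-back

  round : Program n Signal
  round = do
    j ← read s last
    tick
    process j

  -- Run σ Ds τ: started in store σ, which is visited first, the algorithm
  -- visits the list Ds and terminates, in total time τ. Failing runs have no derivation.
  data Run : Store n → List (Matrix n) → ℕ → Set where
    stop : ∀ {σ σ′ τ} → round σ ≡ ((terminate , σ′) after τ) →
           Run σ (a σ ∷ []) (1 + τ)
    loop : ∀ {σ σ′ τ Ds τ′} → round σ ≡ ((go-back , σ′) after τ) →
           Run σ′ Ds τ′ → Run σ (a σ ∷ Ds) (1 + τ + τ′)

-- In a perfect elimination order every directed cycle of an orientation can be shortened at its
-- largest vertex, so an orientation is acyclic as soon as u → v → w implies u → w for u, w < v.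
-- Hence the acyclic orientations of G_v that extend one of G_{v-1} correspond to the cuts of the
-- total order on N_v, and a sweep of v, which flips the arcs at v in this order, meets each of them
-- once; Algorithm A carries out the sweeps of the vertices recursively, a full series of sweeps of
-- the vertices above v taking place between any two flips at v. The sorting of N_v, of cost
-- O(d log d) for d = |N_v|, precedes d flips at v, which pay O(log d) each; d ≥ 1 since G is
-- connected, and d ≤ ω since N_v is a clique.

module Submission where

open import Defs
open import Data.Bool using (Bool; true; false)
import Data.Bool.Properties as Bool
open import Data.Empty using (⊥-elim)
open import Data.Fin using (Fin; zero; suc; inject₁; toℕ; _<_)
open import Data.Fin.Induction using (>-weakInduction)
open import Data.Fin.Properties using (toℕ-inject₁; toℕ-injective; toℕ<n; toℕ-fromℕ; ≤fromℕ; <-cmp)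
  renaming (_≟_ to _≟ᶠ_; <⇒≢ to <ᶠ⇒≢)
open import Data.Fin.Subset using (∣_∣) renaming (_∈_ to _∈ˢ_)
open import Data.List as List using (List; length; []; _∷_; _++_; _∷ʳ_; null; reverse; head; drop; filter)
open import Data.List.Membership.Propositional using (_∈_)
open import Data.List.Membership.Propositional.Properties
  using (∈-++⁺ˡ; ∈-++⁺ʳ; ∈-++⁻; ∈-filter⁺; ∈-filter⁻; ∈-allFin)
open import Data.List.Properties using (length-++; ++-assoc; unfold-reverse)
open import Data.List.Relation.Binary.Permutation.Propositional using (_↭_; ↭-refl; ↭-sym; ↭-trans)
open import Data.List.Relation.Binary.Permutation.Propositional.Properties
  using (↭-reverse; All-resp-↭; ∈-resp-↭; ↭-length)
open import Data.List.Relation.Unary.All as All using (All; []; _∷_)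
import Data.List.Relation.Unary.All.Properties as All
open import Data.List.Relation.Unary.AllPairs using (AllPairs; []; _∷_)
import Data.List.Relation.Unary.AllPairs.Properties as AllPairs
open import Data.List.Relation.Unary.Any using (here; there)
open import Data.List.Relation.Unary.Unique.Propositional using (Unique)
import Data.List.Relation.Unary.Unique.Propositional.Properties as Unique
open import Data.Maybe using (just)
open import Data.Nat using (ℕ; zero; suc; _+_; _*_; _≤_; _⊔_; _≡ᵇ_)
import Data.Nat as ℕ
open import Data.Nat.Logarithm using (⌊log₂_⌋; ⌊log₂⌋-mono-≤)
open import Data.Nat.Properties hiding (<-cmp)
open import Data.Nat.Solver using (module +-*-Solver)
open import Data.Product as Product using (_×_; _,_; proj₁; proj₂; ∃-syntax)
open import Data.Sum as Sum using (_⊎_; inj₁; inj₂; swap; [_,_]′)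
open import Data.Vec using (Vec; []; _∷_; lookup; tabulate; _[_]≔_; _[_]%=_)
open import Data.Vec.Properties
  using ([]=⇒lookup; lookup-replicate; lookup-allFin; lookup∘tabulate;
         lookup∘update; lookup∘update′; lookup∘updateAt; lookup∘updateAt′)
open import Function using (_∘_; flip; _⇔_; mk⇔)
open import Level using (0ℓ)
open import Relation.Binary using (Rel; Tri; tri<; tri≈; tri>)
open import Relation.Binary.Construct.Closure.ReflexiveTransitive as Star using (Star; ε; _◅_; _◅◅_)
open import Relation.Binary.Construct.Closure.Transitive as Plus using (TransClosure; [_])
open import Relation.Binary.PropositionalEquality hiding ([_])
open import Relation.Nullary using (¬_; yes; no; does; Dec)
open import Relation.Nullary.Decidable using (_×-dec_; dec-true)
open import Relation.Unary using (Pred; Decidable)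

-- The obstacle is that the recursion is not explicit in the program: only the array `s` says which
-- vertex comes next. Each level is therefore specified by its effect on `s`: once the vertices
-- above `f` have finished, s_n holds the value that s_f had at the start, and s_f is f again (for
-- `f` below the last vertex). So the next round selects `f` itself or, if `f` has just ended its
-- own sweep, an earlier vertex. A flip at `v` is safe because every larger vertex is then a source
-- or a sink among the vertices up to it, so that the condition on paths of length two is vacuous
-- there. The cost of sorting falls into a single round, before the flips that pay for it; the
-- induction along a sweep therefore carries a credit of κ for each flip still to come. Moreover,
-- N_v is sorted only at the first flip, after a first series of sweeps above `v`. This series ends
-- with the arcs up to `v` as they were, so the order found then is already valid at the start of
-- the sweep.

-- Shortening walks at their largest vertex

module _ {n : ℕ} where

  Below : ℕ → Rel (Fin n) 0ℓ → Rel (Fin n) 0ℓ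
  Below k _⟶_ u v = (u ⟶ v) × toℕ u ℕ.< k × toℕ v ℕ.< k

  -- The alternative `u ≡ w` admits symmetric relations, so that walks in the graph itself can be
  -- shortened as well as directed ones.
  Shortcut : Rel (Fin n) 0ℓ → Set
  Shortcut _⟶_ = ∀ {u v w} → u < v → w < v → u ⟶ v → v ⟶ w → u ≡ w ⊎ u ⟶ w

  below-or-top : ∀ {k} (v : Fin n) → toℕ v ℕ.< suc k → toℕ v ℕ.< k ⊎ toℕ v ≡ k
  below-or-top v v≤k = m≤n⇒m<n∨m≡n (≤-pred v≤k)

  below-top : ∀ {k} {u v : Fin n} → toℕ v ≡ k → toℕ u ℕ.< k → u < v
  below-top v≡k = subst (_ ℕ.<_) (sym v≡k)

  module _ {_⟶_ : Rel (Fin n) 0ℓ} (irrefl : ∀ {u} → ¬ u ⟶ u) (short : Shortcut _⟶_) where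

    bypass : ∀ {k u w} → Star (Below (suc k) _⟶_) u w →
             toℕ u ℕ.< k → toℕ w ℕ.< k → Star (Below k _⟶_) u w
    bypass ε u<k w<k = ε
    bypass (_◅_ {j = v} (u⟶v , _ , v≤k) π) u<k w<k with below-or-top v v≤k
    ... | inj₁ v<k = (u⟶v , u<k , v<k) ◅ bypass π v<k w<k
    bypass (_ ◅ ε) u<k w<k | inj₂ v≡k = ⊥-elim (<-irrefl v≡k w<k)
    bypass ((u⟶v , _) ◅ _◅_ {j = x} (v⟶x , _ , x≤k) π) u<k w<k | inj₂ v≡k
      with below-or-top x x≤k
    ... | inj₂ x≡k with refl ← toℕ-injective (trans x≡k (sym v≡k)) = ⊥-elim (irrefl v⟶x)
    ... | inj₁ x<k with short (below-top v≡k u<k) (below-top v≡k x<k) u⟶v v⟶x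
    ...   | inj₁ refl = bypass π u<k w<k
    ...   | inj₂ u⟶x  = (u⟶x , u<k , x<k) ◅ bypass π x<k w<k

    bypass* : ∀ {k l u w} → Star (Below (l + k) _⟶_) u w →
              toℕ u ℕ.< k → toℕ w ℕ.< k → Star (Below k _⟶_) u w
    bypass* {l = zero}  π u<k w<k = π
    bypass* {l = suc l} π u<k w<k =
      bypass* {l = l} (bypass π (≤-trans u<k (m≤n+m _ l)) (≤-trans w<k (m≤n+m _ l))) u<k w<k

    -- Induction on the bound, removing the top vertex from the closed walk. The closing arc `u ⟶ v`
    -- is kept apart because `bypass` does not apply to a walk with an end at the top; a shortcut
    -- taken there supplies a new closing arc below `k`.
    no-cycle : (∀ {u v} → u ⟶ v → ¬ v ⟶ u) → ∀ k {u v} → Below k _⟶_ u v → ¬ Star (Below k _⟶_) v u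
    no-cycle one-way zero    (_ , () , _)
    no-cycle one-way (suc k) {u} {v} (u⟶v , u≤k , v≤k) π
      with below-or-top u u≤k | below-or-top v v≤k
    ... | inj₁ u<k | inj₁ v<k = no-cycle one-way k (u⟶v , u<k , v<k) (bypass π v<k u<k)
    ... | inj₂ u≡k | inj₂ v≡k with refl ← toℕ-injective (trans u≡k (sym v≡k)) = irrefl u⟶v
    -- The walk ends at the top: `xy` collects it up to its first return there, where `short` turns
    -- the arcs into and out of the top into an arc that closes `xy`.
    ... | inj₂ u≡k | inj₁ v<k = through u≡k v<k u⟶v ε π v<k
      where
      through : ∀ {t x y} → toℕ t ≡ k → toℕ x ℕ.< k → t ⟶ x → Star (Below k _⟶_) x y →
                Star (Below (suc k) _⟶_) y t → ¬ toℕ y ℕ.< k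
      through t≡k x<k t⟶x xy ε y<k = <-irrefl t≡k y<k
      through {y = y} t≡k x<k t⟶x xy (_◅_ {j = z} (y⟶z , _ , z≤k) π) y<k with below-or-top z z≤k
      ... | inj₁ z<k = through t≡k x<k t⟶x (xy ◅◅ (y⟶z , y<k , z<k) ◅ ε) π z<k
      ... | inj₂ z≡k with refl ← toℕ-injective (trans z≡k (sym t≡k))
          with short (below-top t≡k y<k) (below-top t≡k x<k) y⟶z t⟶x
      ...   | inj₁ refl = one-way y⟶z t⟶x
      ...   | inj₂ y⟶x  = no-cycle one-way k (y⟶x , y<k , x<k) xy
    no-cycle one-way (suc k) {u} {v} (u⟶v , u≤k , v≤k) π | inj₁ u<k | inj₂ v≡k = from-top π
      where
      from-top : ¬ Star (Below (suc k) _⟶_) v u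
      from-top ε = irrefl u⟶v
      from-top (_◅_ {j = y} (v⟶y , _ , y≤k) π) with below-or-top y y≤k
      ... | inj₂ y≡k with refl ← toℕ-injective (trans y≡k (sym v≡k)) = irrefl v⟶y
      ... | inj₁ y<k with short (below-top v≡k u<k) (below-top v≡k y<k) u⟶v v⟶y
      ...   | inj₁ refl = one-way u⟶v v⟶y
      ...   | inj₂ u⟶y  = no-cycle one-way k (u⟶y , u<k , y<k) (bypass π y<k u<k)

-- A local criterion for acyclicity in a perfect elimination order

module LocalAcyclicity {n : ℕ} (G : Graph n) (peo : PerfectEliminationOrder G) where
  open Graph G

  -- In this form a flip between `v` and a smaller vertex can disturb `coherent` only at the middle
  -- vertex `v` and at larger ones.
  record LocallyAcyclic (_⟶_ : Rel (Fin n) 0ℓ) : Set where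
    field
      arc⇒edge : ∀ {u v} → u ⟶ v → u ~ v
      edge⇒arc : ∀ {u v} → u ~ v → u ⟶ v ⊎ v ⟶ u
      one-way  : ∀ {u v} → u ⟶ v → ¬ v ⟶ u
      coherent : ∀ {u v w} → u < v → w < v → u ⟶ v → v ⟶ w → u ⟶ w

    arc-irrefl : ∀ {u} → ¬ u ⟶ u
    arc-irrefl u⟶u = ~-irrefl refl (arc⇒edge u⟶u)

    acyclic : ∀ {k u v} → Below k _⟶_ u v → ¬ Star (Below k _⟶_) v u
    acyclic = no-cycle arc-irrefl (λ u<v w<v u⟶v v⟶w → inj₂ (coherent u<v w<v u⟶v v⟶w)) one-way _

    -- `coherent` says nothing about a middle vertex smaller than one of the ends; there the
    -- opposite arc `w ⟶ u` would close a cycle.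
    transitive : ∀ {u v w} → u ~ w → u ⟶ v → v ⟶ w → u ⟶ w
    transitive u~w u⟶v v⟶w with edge⇒arc u~w
    ... | inj₁ u⟶w = u⟶w
    ... | inj₂ w⟶u = ⊥-elim (acyclic (everywhere u⟶v) (everywhere v⟶w ◅ everywhere w⟶u ◅ ε))
      where
      everywhere : ∀ {u v} → u ⟶ v → Below n _⟶_ u v
      everywhere u⟶v = u⟶v , toℕ<n _ , toℕ<n _

  open LocallyAcyclic

  reversed : ∀ {_⟶_ : Rel (Fin n) 0ℓ} → LocallyAcyclic _⟶_ → LocallyAcyclic (flip _⟶_)
  reversed ac = record
    { arc⇒edge = ~-sym ∘ arc⇒edge ac
    ; edge⇒arc = swap ∘ edge⇒arc ac
    ; one-way  = one-way ac
    ; coherent = λ u<v w<v v⟶u w⟶v → coherent ac w<v u<v w⟶v v⟶u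
    }

  private
    first-step : ∀ {_⟶_ : Rel (Fin n) 0ℓ} {u v} → TransClosure _⟶_ u v →
                 ∃[ w ] (Below n _⟶_ u w × Star (Below n _⟶_) w v)
    first-step [ u⟶v ]           = _ , (u⟶v , toℕ<n _ , toℕ<n _) , ε
    first-step (u⟶w Plus.∷ w⟶⁺v) with first-step w⟶⁺v
    ... | _ , w⟶x , x⟶*v = _ , (u⟶w , toℕ<n _ , toℕ<n _) , w⟶x ◅ x⟶*v

  locallyAcyclic⇒acyclicOrientation : ∀ a → LocallyAcyclic (Arc a) → IsAcyclicOrientation G a
  locallyAcyclic⇒acyclicOrientation a ac = record
    { arc⇒edge = arc⇒edge ac
    ; edge⇒arc = edge⇒arc ac
    ; one-way  = one-way ac
    ; acyclic  = λ { refl cycle → let _ , u⟶w , w⟶*u = first-step cycle in acyclic ac u⟶w w⟶*u }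
    }

  acyclicOrientation⇒locallyAcyclic : ∀ a → IsAcyclicOrientation G a → LocallyAcyclic (Arc a)
  acyclicOrientation⇒locallyAcyclic a ao = record
    { arc⇒edge = AO.arc⇒edge
    ; edge⇒arc = AO.edge⇒arc
    ; one-way  = AO.one-way
    ; coherent = coh
    }
    where
    module AO = IsAcyclicOrientation ao
    coh : ∀ {u v w} → u < v → w < v → Arc a u v → Arc a v w → Arc a u w
    coh {u} {v} {w} u<v w<v u⟶v v⟶w with u ≟ᶠ w
    ... | yes refl = ⊥-elim (AO.one-way u⟶v v⟶w)
    ... | no u≢w with AO.edge⇒arc (peo v (u<v , AO.arc⇒edge u⟶v) (w<v , ~-sym (AO.arc⇒edge v⟶w)) u≢w)
    ...   | inj₁ u⟶w = u⟶w
    ...   | inj₂ w⟶u = ⊥-elim (AO.acyclic refl (u⟶v Plus.∷ v⟶w Plus.∷ [ w⟶u ]))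

  -- A walk from `v` to `u` can be shortened until it stays within the vertices up to `v`; its first
  -- step then leads to an earlier neighbour.
  hasEarlierNeighbour : Connected G → ∀ {u v} → u < v → ∃[ w ] EarlierNeighbour G v w
  hasEarlierNeighbour connected {u} {v} u<v with m≤n⇒∃[o]m+o≡n (toℕ<n v)
  ... | l , eq with bypass* (~-irrefl refl) short {k = suc (toℕ v)} {l = l} path (n<1+n _) (m<n⇒m<1+n u<v)
    where
    short : Shortcut _~_
    short {x} {y} {z} x<y z<y x~y y~z with x ≟ᶠ z
    ... | yes x≡z = inj₁ x≡z
    ... | no  x≢z = inj₂ (peo y (x<y , x~y) (z<y , ~-sym y~z) x≢z)
    path : Star (Below (l + suc (toℕ v)) _~_) v u
    path = subst (λ k → Star (Below k _~_) v u) (trans (sym eq) (+-comm (suc (toℕ v)) l))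
                 (Star.map (λ e → e , toℕ<n _ , toℕ<n _) (connected v u))
  ... | ε = ⊥-elim (<-irrefl refl u<v)
  ... | _◅_ {j = w} (v~w , _ , w≤v) _ with below-or-top w w≤v
  ...   | inj₁ w<v = w , w<v , ~-sym v~w
  ...   | inj₂ w≡v = ⊥-elim (~-irrefl (toℕ-injective (sym w≡v)) v~w)

-- Orientations as matrices: directions, agreement on initial segments, flips

opposite : Side → Side
opposite L = R
opposite R = L

true-ext : ∀ {b c} → (b ≡ true → c ≡ true) → (c ≡ true → b ≡ true) → b ≡ c
true-ext {false} {false} f g = refl
true-ext {false} {true}  f g = g refl
true-ext {true}          f g = sym (f refl)

module _ {n : ℕ} where

  private variable
    b c D : Matrix n
    i j u v w x : Fin n

  lookup-ext : ∀ {A : Set} {k} {xs ys : Vec A k} → (∀ i → lookup xs i ≡ lookup ys i) → xs ≡ ys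
  lookup-ext {xs = []}     {[]}     eq = refl
  lookup-ext {xs = x ∷ xs} {y ∷ ys} eq = cong₂ _∷_ (eq zero) (lookup-ext (eq ∘ suc))

  set : Matrix n → Fin n → Fin n → Bool → Matrix n
  set b i j z = b [ i ]%= (_[ j ]≔ z)

  entry-set : ∀ b (i j : Fin n) {z} → entry (set b i j z) i j ≡ z
  entry-set b i j = trans (cong (λ row → lookup row j) (lookup∘updateAt i b)) (lookup∘updateAt j (lookup b i))

  entry-set′ : ∀ b (i j : Fin n) {z} → ¬ (u ≡ i × w ≡ j) → entry (set b i j z) u w ≡ entry b u w
  entry-set′ {u} {w} b i j ≢ij with u ≟ᶠ i
  ... | no u≢i = cong (λ row → lookup row w) (lookup∘updateAt′ u i u≢i b)
  ... | yes refl = trans (cong (λ row → lookup row w) (lookup∘updateAt i b))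
                         (lookup∘updateAt′ w j (λ w≡j → ≢ij (refl , w≡j)) (lookup b i))

  -- The arcs of b, or the reversed arcs: in the direction belonging to o_j = o, a sweep of j
  -- begins with all arcs leaving j and ends with all arcs entering j.
  Directed : Side → Matrix n → Rel (Fin n) 0ℓ
  Directed R b u v = Arc b u v
  Directed L b u v = Arc b v u

  directed? : ∀ o (b : Matrix n) u v → Dec (Directed o b u v)
  directed? R b u v = entry b u v Bool.≟ true
  directed? L b u v = entry b v u Bool.≟ true

  directed-opposite : ∀ o → Directed (opposite o) b u v → Directed o b v u
  directed-opposite L e = e
  directed-opposite R e = e

  record AgreeBelow (k : ℕ) (b c : Matrix n) : Set where
    constructor agreeing
    field agree : ∀ {u w} → toℕ u ℕ.< k → toℕ w ℕ.< k → entry b u w ≡ entry c u w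

  open AgreeBelow

  agree-refl : ∀ {k} → AgreeBelow k b b
  agree-refl .agree _ _ = refl

  agree-sym : ∀ {k} → AgreeBelow k b c → AgreeBelow k c b
  agree-sym bc .agree u<k w<k = sym (bc .agree u<k w<k)

  agree-trans : ∀ {k} → AgreeBelow k b c → AgreeBelow k c D → AgreeBelow k b D
  agree-trans bc cd .agree u<k w<k = trans (bc .agree u<k w<k) (cd .agree u<k w<k)

  agree-≤ : ∀ {k l} → k ℕ.≤ l → AgreeBelow l b c → AgreeBelow k b c
  agree-≤ k≤l bc .agree u<k w<k = bc .agree (≤-trans u<k k≤l) (≤-trans w<k k≤l)

  agree⇒≡ : AgreeBelow n b c → b ≡ c
  agree⇒≡ bc = lookup-ext λ i → lookup-ext λ j → bc .agree (toℕ<n i) (toℕ<n j)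

  agree-directed : ∀ {k} o → AgreeBelow k b c → toℕ u ℕ.< k → toℕ w ℕ.< k →
                   Directed o b u w → Directed o c u w
  agree-directed R bc u<k w<k e = trans (sym (bc .agree u<k w<k)) e
  agree-directed L bc u<k w<k e = trans (sym (bc .agree w<k u<k)) e

  directed-agree : ∀ {k} o →
                   (∀ {u w} → toℕ u ℕ.< k → toℕ w ℕ.< k → Directed o b u w → Directed o c u w) →
                   (∀ {u w} → toℕ u ℕ.< k → toℕ w ℕ.< k → Directed o c u w → Directed o b u w) →
                   AgreeBelow k b c
  directed-agree R bc cb .agree u<k w<k = true-ext (bc u<k w<k) (cb u<k w<k)
  directed-agree L bc cb .agree u<k w<k = true-ext (bc w<k u<k) (cb w<k u<k)

  flipped : Side → Matrix n → Fin n → Fin n → Matrix n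
  flipped L b i j = set (set b i j false) j i true
  flipped R b i j = set (set b i j true) j i false

  private
    ends-distinct : i ≢ j → ¬ (i ≡ j × j ≡ i)
    ends-distinct i≢j (i≡j , _) = i≢j i≡j

  entry-flipped : ∀ o b → ¬ (u ≡ i × w ≡ j) → ¬ (u ≡ j × w ≡ i) →
                  entry (flipped o b i j) u w ≡ entry b u w
  entry-flipped {i = i} {j = j} L b ≢ij ≢ji =
    trans (entry-set′ (set b i j false) j i ≢ji) (entry-set′ b i j ≢ij)
  entry-flipped {i = i} {j = j} R b ≢ij ≢ji =
    trans (entry-set′ (set b i j true) j i ≢ji) (entry-set′ b i j ≢ij)

  flipped-arc : ∀ o b → i ≢ j → Directed o (flipped o b i j) i j
  flipped-arc {i} {j} L b i≢j = entry-set (set b i j false) j i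
  flipped-arc {i} {j} R b i≢j =
    trans (entry-set′ (set b i j true) j i (ends-distinct i≢j)) (entry-set b i j)

  flipped-¬arc : ∀ o b → i ≢ j → ¬ Directed o (flipped o b i j) j i
  flipped-¬arc {i} {j} L b i≢j = Bool.not-¬
    (trans (entry-set′ (set b i j false) j i (ends-distinct i≢j)) (entry-set b i j))
  flipped-¬arc {i} {j} R b i≢j = Bool.not-¬ (entry-set (set b i j true) j i)

  directed-≡ : ∀ o → entry b u w ≡ entry c u w → entry b w u ≡ entry c w u →
               Directed o b u w → Directed o c u w
  directed-≡ R eq eq′ e = trans (sym eq) e
  directed-≡ L eq eq′ e = trans (sym eq′) e

  flipped-keeps : ∀ o b → ¬ (u ≡ i × w ≡ j) → ¬ (u ≡ j × w ≡ i) →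
                  Directed o b u w → Directed o (flipped o b i j) u w
  flipped-keeps o b ≢ij ≢ji = directed-≡ o (sym (entry-flipped o b ≢ij ≢ji))
    (sym (entry-flipped o b (λ { (p , q) → ≢ji (q , p) }) (λ { (p , q) → ≢ij (q , p) })))

  flipped-old : ∀ o b → i ≢ j → Directed o (flipped o b i j) u w →
                (u ≡ i × w ≡ j) ⊎ (¬ (u ≡ j × w ≡ i) × Directed o b u w)
  flipped-old {i} {j} {u} {w} o b i≢j e with (u ≟ᶠ i) ×-dec (w ≟ᶠ j) | (u ≟ᶠ j) ×-dec (w ≟ᶠ i)
  ... | yes ≡ij | _ = inj₁ ≡ij
  ... | no _ | yes (refl , refl) = ⊥-elim (flipped-¬arc o b i≢j e)
  ... | no ≢ij | no ≢ji = inj₂ (≢ji , directed-≡ o (entry-flipped o b ≢ij ≢ji)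
    (entry-flipped o b (λ { (p , q) → ≢ji (q , p) }) (λ { (p , q) → ≢ij (q , p) })) e)

-- Flips that preserve acyclicity

module _ {n : ℕ} (G : Graph n) (peo : PerfectEliminationOrder G) where
  open Graph G
  open LocalAcyclicity G peo
  open LocallyAcyclic

  locallyAcyclic-directed : ∀ o {b} → LocallyAcyclic (Arc b) → LocallyAcyclic (Directed o b)
  locallyAcyclic-directed L ac = reversed ac
  locallyAcyclic-directed R ac = ac

  locallyAcyclic-undirected : ∀ o {b} → LocallyAcyclic (Directed o b) → LocallyAcyclic (Arc b)
  locallyAcyclic-undirected L ac = reversed ac
  locallyAcyclic-undirected R ac = ac

  directed-split : ∀ o {b u v} → LocallyAcyclic (Directed o b) → u ~ v → ¬ Directed o b u v → Directed o b v u
  directed-split o ac u~v ¬u⟶v with edge⇒arc ac u~v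
  ... | inj₁ u⟶v = ⊥-elim (¬u⟶v u⟶v)
  ... | inj₂ v⟶u = v⟶u

  -- Middle vertices below `v` do not see the flipped arc, at `v` the hypothesis `first` provides
  -- the arcs out of `x`, and above `v` no path passes, by `extremal`.
  flipped-locallyAcyclic : ∀ o b {x v} → LocallyAcyclic (Directed o b) → x < v → Directed o b v x →
    (∀ {w} → w < v → w ≢ x → Directed o b v w → Directed o b x w) →
    (∀ {j u w} → v < j → u < j → w < j → Directed o b u j → ¬ Directed o b j w) →
    LocallyAcyclic (Directed o (flipped o b x v))
  flipped-locallyAcyclic o b {x} {v} ac x<v v⟶x first extremal = record
    { arc⇒edge = edge
    ; edge⇒arc = arc
    ; one-way  = one
    ; coherent = coh
    }
    where
    b′ = flipped o b x v
    x≢v = <ᶠ⇒≢ x<v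
    old : ∀ {u w} → Directed o b′ u w → (u ≡ x × w ≡ v) ⊎ (¬ (u ≡ v × w ≡ x) × Directed o b u w)
    old = flipped-old o b x≢v
    edge : ∀ {u w} → Directed o b′ u w → u ~ w
    edge e with old e
    ... | inj₁ (refl , refl) = ~-sym (arc⇒edge ac v⟶x)
    ... | inj₂ (_ , e′)      = arc⇒edge ac e′
    arc : ∀ {u w} → u ~ w → Directed o b′ u w ⊎ Directed o b′ w u
    arc {u} {w} u~w with (u ≟ᶠ x) ×-dec (w ≟ᶠ v) | (u ≟ᶠ v) ×-dec (w ≟ᶠ x)
    ... | yes (refl , refl) | _ = inj₁ (flipped-arc o b x≢v)
    ... | no _   | yes (refl , refl) = inj₂ (flipped-arc o b x≢v)
    ... | no ≢xv | no ≢vx with edge⇒arc ac u~w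
    ...   | inj₁ e = inj₁ (flipped-keeps o b ≢xv ≢vx e)
    ...   | inj₂ e = inj₂ (flipped-keeps o b (λ { (p , q) → ≢vx (q , p) }) (λ { (p , q) → ≢xv (q , p) }) e)
    one : ∀ {u w} → Directed o b′ u w → ¬ Directed o b′ w u
    one e e′ with old e | old e′
    ... | inj₁ (refl , refl) | _ = flipped-¬arc o b x≢v e′
    ... | inj₂ _ | inj₁ (refl , refl) = flipped-¬arc o b x≢v e
    ... | inj₂ (_ , d) | inj₂ (_ , d′) = one-way ac d d′
    coh : ∀ {u j w} → u < j → w < j → Directed o b′ u j → Directed o b′ j w → Directed o b′ u w
    coh {u} {j} {w} u<j w<j u⟶j j⟶w with old u⟶j | old j⟶w
    ... | inj₁ (refl , refl) | inj₁ (refl , _) = ⊥-elim (<-irrefl refl u<j)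
    ... | inj₁ (refl , refl) | inj₂ (≢vx , j⟶w′) =
      flipped-keeps o b (λ { (_ , refl) → <-irrefl refl w<j }) (λ { (p , _) → x≢v p })
                    (first w<j (λ w≡x → ≢vx (refl , w≡x)) j⟶w′)
    ... | inj₂ _ | inj₁ (refl , refl) = ⊥-elim (<-asym x<v w<j)
    ... | inj₂ (_ , u⟶j′) | inj₂ (_ , j⟶w′) with <-cmp v j
    ...   | tri< v<j _ _ = ⊥-elim (extremal v<j u<j w<j u⟶j′ j⟶w′)
    ...   | tri≈ _ refl _ =
      flipped-keeps o b (λ { (_ , refl) → <-irrefl refl w<j }) (λ { (refl , _) → <-irrefl refl u<j })
        (coherent ac u<j w<j u⟶j′ j⟶w′)
    ...   | tri> _ _ j<v =
      flipped-keeps o b (λ { (_ , refl) → <-asym j<v w<j }) (λ { (refl , _) → <-asym j<v u<j })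
        (coherent ac u<j w<j u⟶j′ j⟶w′)

  -- Arcs run along edges only, so the arcs between `v` and its earlier neighbours decide all
  -- entries of `v` up to `v`.
  agree-top : ∀ o {b c v} → LocallyAcyclic (Directed o b) → LocallyAcyclic (Directed o c) →
    AgreeBelow (toℕ v) b c →
    (∀ {u} → EarlierNeighbour G v u →
      (Directed o b u v × Directed o c u v) ⊎ (Directed o b v u × Directed o c v u)) →
    AgreeBelow (suc (toℕ v)) b c
  agree-top o {v = v} acb acc below at-v =
    directed-agree o (half acb below at-v)
      (half acc (agree-sym below) (Sum.map Product.swap Product.swap ∘ at-v))
    where
    half : ∀ {b c} → LocallyAcyclic (Directed o b) → AgreeBelow (toℕ v) b c →
      (∀ {u} → EarlierNeighbour G v u →
        (Directed o b u v × Directed o c u v) ⊎ (Directed o b v u × Directed o c v u)) →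
      ∀ {u w} → toℕ u ℕ.< suc (toℕ v) → toℕ w ℕ.< suc (toℕ v) → Directed o b u w → Directed o c u w
    half ac below at-v {u} {w} u≤v w≤v e with below-or-top u u≤v | below-or-top w w≤v
    ... | inj₁ u<v | inj₁ w<v = agree-directed o below u<v w<v e
    ... | inj₁ u<v | inj₂ w≡v with refl ← toℕ-injective w≡v | at-v (u<v , arc⇒edge ac e)
    ...   | inj₁ (_ , e′) = e′
    ...   | inj₂ (e″ , _) = ⊥-elim (one-way ac e e″)
    half ac below at-v {u} {w} u≤v w≤v e | inj₂ u≡v | inj₁ w<v
      with refl ← toℕ-injective u≡v | at-v (w<v , ~-sym (arc⇒edge ac e))
    ...   | inj₁ (e″ , _) = ⊥-elim (one-way ac e e″)
    ...   | inj₂ (_ , e′) = e′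
    half {b} ac below at-v {u} {w} u≤v w≤v e | inj₂ u≡v | inj₂ w≡v =
      ⊥-elim (arc-irrefl ac (subst (λ z → Directed o b z w) (toℕ-injective (trans u≡v (sym w≡v))) e))

-- Effect and cost of a single round

head-drop-++ : ∀ {A : Set} (xs : List A) {y ys} → head (drop (length xs) (xs ++ y ∷ ys)) ≡ just y
head-drop-++ []       = refl
head-drop-++ (x ∷ xs) = head-drop-++ xs

module Execution (S : SortingAlgorithm) {m : ℕ} (G : Graph (suc m)) where
  open AlgorithmA S G
  open SortingAlgorithm S

  round-≡ : ∀ {σ j r τ} → lookup (s σ) last ≡ j → process j σ ≡ (r after τ) → round σ ≡ (r after (2 + τ))
  round-≡ refl process≡ rewrite process≡ = refl

  private
    n = suc m

  sorted : Side → List (Fin n) → List (Fin n)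
  sorted L = reverse
  sorted R = λ vs → vs

  sortResult : Fin n → Store n → Timed (List (Fin n))
  sortResult j σ = sort (λ u v → entry (a σ) u v after 1) (N j)

  withSorted : Fin n → Side → Store n → Store n
  withSorted j side σ = record σ { T = T σ [ j ]≔ sorted side (value (sortResult j σ)) }

  withFlipped : Fin n → Side → ℕ → Fin n → Store n → Store n
  withFlipped j side c x σ = record σ { t = t σ [ j ]≔ suc c ; a = flipped side (a σ) x j }

  updated : Bool → Fin n → Fin n → Side → Store n → Store n
  updated false j j-1 side σ = record σ { s = s σ [ last ]≔ last }
  updated true  j j-1 side σ = record σ
    { t = t σ [ j ]≔ 0
    ; o = o σ [ j ]≔ opposite side
    ; s = s σ [ last ]≔ last [ j ]≔ lookup (s σ [ last ]≔ last) j-1 [ j-1 ]≔ j-1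
    }

  -- Writing s_n, reading t_j and |N_j| and the test cost 4. A turn adds 7: three for o_j, one for
  -- t_j and three for the exchange in `s`.
  updateTime : Bool → ℕ
  updateTime false = 4
  updateTime true  = 11

  -- A branch on a read must be resolved before later reads of the same entry show up in the goal,
  -- which is why equations are rewritten repeatedly.
  process-idle : ∀ {σ c side x b} i → let j = suc i in
    lookup (t σ) j ≡ suc c → lookup (o σ) j ≡ side →
    head (drop (suc c) (lookup (T σ) j)) ≡ just x →
    (lookup (t σ [ j ]≔ suc (suc c)) j ≡ᵇ length (N j)) ≡ b →
    process j σ ≡ ((go-back , updated b j (inject₁ i) side (withFlipped j side (suc c) x σ))
                    after (11 + (updateTime b + 0)))
  process-idle {side = L} {b = false} i t≡ o≡ T≡ d≡ rewrite t≡ | t≡ | T≡ | o≡ | d≡ = refl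
  process-idle {side = L} {b = true}  i t≡ o≡ T≡ d≡ rewrite t≡ | t≡ | T≡ | o≡ | d≡ | o≡ = refl
  process-idle {side = R} {b = false} i t≡ o≡ T≡ d≡ rewrite t≡ | t≡ | T≡ | o≡ | d≡ = refl
  process-idle {side = R} {b = true}  i t≡ o≡ T≡ d≡ rewrite t≡ | t≡ | T≡ | o≡ | d≡ | o≡ = refl

  -- Reading and testing t_j costs 2, as does reading and testing o_j once N_j is read and sorted;
  -- the 9 units consist of 8 for the flip and the further tick of `process`.
  process-sort : ∀ {σ side x b} i → let j = suc i ; σ₁ = withSorted j side σ in
    lookup (t σ) j ≡ 0 → lookup (o σ) j ≡ side →
    head (lookup (T σ₁) j) ≡ just x →
    (lookup (t σ [ j ]≔ 1) j ≡ᵇ length (N j)) ≡ b →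
    process j σ ≡ ((go-back , updated b j (inject₁ i) side (withFlipped j side 0 x σ₁)) after
      (2 + (length (N j) + 0 + (time (sortResult j σ) + (2 + length (sorted side (value (sortResult j σ))))))
         + (9 + (updateTime b + 0))))
  process-sort {side = L} {b = false} i t≡ o≡ T≡ d≡ rewrite t≡ | o≡ | t≡ | T≡ | o≡ | d≡ = refl
  process-sort {side = L} {b = true}  i t≡ o≡ T≡ d≡ rewrite t≡ | o≡ | t≡ | T≡ | o≡ | d≡ | o≡ = refl
  process-sort {side = R} {b = false} i t≡ o≡ T≡ d≡ rewrite t≡ | o≡ | t≡ | T≡ | o≡ | d≡ = refl
  process-sort {side = R} {b = true}  i t≡ o≡ T≡ d≡ rewrite t≡ | o≡ | t≡ | T≡ | o≡ | d≡ | o≡ = refl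

-- Runs that visit a prescribed set once, with amortised cost

module Coverage (S : SortingAlgorithm) {m : ℕ} (G : Graph (suc m)) (K : ℕ) where
  open AlgorithmA S G

  private
    n = suc m

  -- The stores before each of the listed visits are left, the last store is reached but not yet visited.
  data Segment : Store n → List (Matrix n) → Store n → ℕ → Set where
    done : ∀ {σ} → Segment σ [] σ 0
    step : ∀ {σ σ₁ σ₂ τ Ds τ′} → round σ ≡ ((go-back , σ₁) after τ) →
           Segment σ₁ Ds σ₂ τ′ → Segment σ (a σ ∷ Ds) σ₂ (1 + τ + τ′)

  segment-++ : ∀ {σ σ₁ σ₂ Ds Es τ τ′} → Segment σ Ds σ₁ τ → Segment σ₁ Es σ₂ τ′ →
               Segment σ (Ds ++ Es) σ₂ (τ + τ′)
  segment-++ done                        seg′ = seg′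
  segment-++ {τ′ = τ″} (step {τ = τ} {τ′ = τ′} round≡ seg) seg′ =
    subst (Segment _ _ _) (sym (+-assoc (1 + τ) τ′ τ″)) (step round≡ (segment-++ seg seg′))

  segment-run : ∀ {σ σ₁ σ₂ Ds τ τ′} → Segment σ Ds σ₁ τ → round σ₁ ≡ ((terminate , σ₂) after τ′) →
                Run σ (Ds ++ a σ₁ ∷ []) (τ + (1 + τ′))
  segment-run done                      stop≡ = stop stop≡
  segment-run {τ′ = τ″} (step {τ = τ} {τ′ = τ′} round≡ seg) stop≡ =
    subst (Run _ _) (sym (+-assoc (1 + τ) τ′ (1 + τ″))) (loop round≡ (segment-run seg stop≡))

  -- The credit is time that the segment has in reserve to pay for work done before it.
  record Cover (P : Matrix n → Set) (credit : ℕ) (σ σ′ : Store n) : Set where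
    field
      {left}     : List (Matrix n)
      {duration} : ℕ
      segment    : Segment σ left σ′ duration
      amortised  : duration + credit ≤ K * length left

    visited : List (Matrix n)
    visited = left ++ a σ′ ∷ []

    field
      unique   : Unique visited
      sound    : ∀ {D} → D ∈ visited → P D
      complete : ∀ {D} → P D → D ∈ visited

  open Cover

  cover-map : ∀ {P Q : Matrix n → Set} {credit σ σ′} → (∀ {D} → P D → Q D) → (∀ {D} → Q D → P D) →
              Cover P credit σ σ′ → Cover Q credit σ σ′
  cover-map P⇒Q Q⇒P c = record
    { segment   = segment c
    ; amortised = amortised c
    ; unique    = unique c
    ; sound     = λ D∈ → P⇒Q (sound c D∈)
    ; complete  = λ q → complete c (Q⇒P q)
    }

  cover-stay : ∀ {P : Matrix n → Set} {σ} → P (a σ) → (∀ {D} → P D → D ≡ a σ) → Cover P 0 σ σ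
  cover-stay Pσ onlyσ = record
    { segment   = done
    ; amortised = ℕ.z≤n
    ; unique    = [] ∷ []
    ; sound     = λ { (here refl) → Pσ }
    ; complete  = λ p → here (onlyσ p)
    }

  -- The round between the two covers is paid by the visit of `σ₁`, which now counts as left, and by
  -- the credit of the second cover; what remains becomes the new credit.
  cover-join : ∀ {P Q R : Matrix n → Set} {credit credit′ σ σ₁ σ₂ σ₃ τ} →
    Cover P 0 σ σ₁ → round σ₁ ≡ ((go-back , σ₂) after τ) → Cover Q credit′ σ₂ σ₃ →
    suc τ + credit ≤ K + credit′ →
    (∀ {D} → P D → ¬ Q D) → (∀ {D} → P D → R D) → (∀ {D} → Q D → R D) → (∀ {D} → R D → P D ⊎ Q D) →
    Cover R credit σ σ₃
  cover-join {credit = credit} {credit′} {σ₁ = σ₁} {σ₃ = σ₃} {τ = τ} p round≡ q time≤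
             disjoint P⇒R Q⇒R R⇒P⊎Q = record
    { segment   = segment-++ (segment p) (step round≡ (segment q))
    ; amortised = time-bound
    ; unique    = subst Unique reassoc
        (Unique.++⁺ (unique p) (unique q) λ (∈p , ∈q) → disjoint (sound p ∈p) (sound q ∈q))
    ; sound     = λ D∈ → [ (λ ∈p → P⇒R (sound p ∈p)) , (λ ∈q → Q⇒R (sound q ∈q)) ]′
                          (∈-++⁻ (visited p) (subst (_ ∈_) (sym reassoc) D∈))
    ; complete  = λ r → subst (_ ∈_) reassoc
        ([ (λ p′ → ∈-++⁺ˡ (complete p p′)) , (λ q′ → ∈-++⁺ʳ (visited p) (complete q q′)) ]′ (R⇒P⊎Q r))
    }
    where
    reassoc : visited p ++ visited q ≡ (left p ++ a σ₁ ∷ left q) ++ a σ₃ ∷ []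
    reassoc = trans (++-assoc (left p) (a σ₁ ∷ []) (visited q))
                    (sym (++-assoc (left p) (a σ₁ ∷ left q) (a σ₃ ∷ [])))
    time-bound : duration p + (1 + τ + duration q) + credit ≤ K * length (left p ++ a σ₁ ∷ left q)
    -- The second cover is bounded only together with its credit, so `credit′` is added on both
    -- sides.
    time-bound = +-cancelʳ-≤ credit′ _ _ (begin
      duration p + (1 + τ + duration q) + credit + credit′
        ≡⟨ solve 5 (λ d τ e c c′ → d :+ (con 1 :+ τ :+ e) :+ c :+ c′ :=
                              d :+ con 0 :+ (con 1 :+ τ :+ c) :+ (e :+ c′)) refl
                 (duration p) τ (duration q) credit credit′ ⟩
      duration p + 0 + (suc τ + credit) + (duration q + credit′)
        ≤⟨ +-mono-≤ (+-mono-≤ (amortised p) time≤) (amortised q) ⟩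
      K * length (left p) + (K + credit′) + K * length (left q)
        ≡⟨ solve 4 (λ k l c′ l′ → k :* l :+ (k :+ c′) :+ k :* l′ := k :* (l :+ (con 1 :+ l′)) :+ c′) refl
                 K (length (left p)) credit′ (length (left q)) ⟩
      K * (length (left p) + suc (length (left q))) + credit′
        ≡⟨ cong (λ l → K * l + credit′) (sym (length-++ (left p))) ⟩
      K * length (left p ++ a σ₁ ∷ left q) + credit′ ∎)
      where open ≤-Reasoning
            open +-*-Solver

-- Invariants of the recursion and of a sweep

allPairs-++⁻ʳ : ∀ {A : Set} {_≺_ : A → A → Set} xs {ys} → AllPairs _≺_ (xs ++ ys) → AllPairs _≺_ ys
allPairs-++⁻ʳ []       ps       = ps
allPairs-++⁻ʳ (x ∷ xs) (_ ∷ ps) = allPairs-++⁻ʳ xs ps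

module Invariants (S : SortingAlgorithm) {m : ℕ} (G : Graph (suc m)) (peo : PerfectEliminationOrder G)
  (K : ℕ) where
  open Graph G
  open AlgorithmA S G
  open LocalAcyclicity G peo
  open LocallyAcyclic
  open Execution S G
  open Coverage S G K

  private
    n = suc m

  -- The vertices from `k` on are about to start a sweep, and o_j records their position among the
  -- vertices up to j: L for a sink, R for a source.
  record Resting (k : ℕ) (σ : Store n) : Set where
    field
      acyclic-arcs : LocallyAcyclic (Arc (a σ))
      t≡0          : ∀ {j} → k ≤ toℕ j → lookup (t σ) j ≡ 0
      extremal     : ∀ {j u} → k ≤ toℕ j → u < j → ¬ Directed (lookup (o σ) j) (a σ) u j

  Focused : ℕ → Store n → Set
  Focused k σ = ∀ {j} → k ≤ toℕ j → lookup (s σ) j ≡ j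

  -- With k = f + 1, `s-own` includes `f` itself. It leaves out the last vertex, whose entry passes
  -- on the old value of s_f.
  record Swept (k : ℕ) (f : Fin n) (σ σ′ : Store n) : Set where
    field
      resting : Resting k σ′
      agrees  : AgreeBelow k (a σ) (a σ′)
      t-kept  : ∀ {j} → toℕ j ℕ.< k → lookup (t σ′) j ≡ lookup (t σ) j
      o-kept  : ∀ {j} → toℕ j ℕ.< k → lookup (o σ′) j ≡ lookup (o σ) j
      T-kept  : ∀ {j} → toℕ j ℕ.< k → lookup (T σ′) j ≡ lookup (T σ) j
      s-last  : lookup (s σ′) last ≡ lookup (s σ) f
      s-own   : ∀ {j} → k ≤ suc (toℕ j) → j < last → lookup (s σ′) j ≡ j
      s-kept  : ∀ {j} → suc (toℕ j) ℕ.< k → lookup (s σ′) j ≡ lookup (s σ) j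

  Extends : ℕ → Matrix n → Matrix n → Set
  Extends k b D = LocallyAcyclic (Arc D) × AgreeBelow k b D

  -- Used with k = f + 1: the vertices from k on run through all their positions, after which s_n
  -- selects the vertex s_f.
  Phase : ℕ → Fin n → Set
  Phase k f = ∀ {σ} → Resting k σ → Focused k σ →
              ∃[ σ′ ] (Swept k f σ σ′ × Cover (Extends k (a σ)) 0 σ σ′)

  open Resting
  open Swept

  phase-last : Phase n last
  phase-last {σ} rest focus = σ , swept , cover-stay (acyclic-arcs rest , agree-refl) (sym ∘ agree⇒≡ ∘ proj₂)
    where
    swept : Swept n last σ σ
    swept .resting = rest
    swept .agrees = agree-refl
    swept .t-kept _ = refl
    swept .o-kept _ = refl
    swept .T-kept _ = refl
    swept .s-last = refl
    swept .s-own {j} m≤j j<m = ⊥-elim (<⇒≱ (subst (toℕ j ℕ.<_) (toℕ-fromℕ m) j<m) (≤-pred m≤j))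
    swept .s-kept _ = refl

  module Sweep (i : Fin m) (σ₀ : Store n) (ws : List (Fin n)) where

    v = suc i
    f = inject₁ i
    side = lookup (o σ₀) v

    k = toℕ v

    f+1≡v : suc (toℕ f) ≡ k
    f+1≡v = cong suc (toℕ-inject₁ i)

    record Order : Set where
      field
        sound    : ∀ {u} → u ∈ ws → EarlierNeighbour G v u
        complete : ∀ {u} → EarlierNeighbour G v u → u ∈ ws
        chain    : AllPairs (Directed side (a σ₀)) ws
        count    : length ws ≡ length (N v)

    -- The Boolean tells whether the sweep has ended. If so, `v` has turned, s_v has taken over the
    -- old value of s_f, and s_f is f again.
    Status : Bool → ℕ → Store n → Set
    Status true  c σ =
      lookup (t σ) v ≡ 0 × lookup (o σ) v ≡ opposite side ×
      lookup (s σ) v ≡ lookup (s σ₀) f × lookup (s σ) f ≡ f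
    Status false c σ =
      lookup (t σ) v ≡ c × lookup (o σ) v ≡ side ×
      lookup (s σ) v ≡ v × lookup (s σ) f ≡ lookup (s σ₀) f

    -- `pre` lists the neighbours whose arcs are flipped already, `post` those to come. T_v is
    -- computed only at the first flip, hence the condition in `T-own`.
    record Sweeping (pre post : List (Fin n)) (σ : Store n) : Set where
      field
        resting : Resting (suc k) σ
        focused : Focused (suc k) σ
        agrees  : AgreeBelow k (a σ₀) (a σ)
        in-arcs  : All (λ u → Directed side (a σ) u v) pre
        out-arcs : All (λ u → Directed side (a σ) v u) post
        status  : Status (null post) (length pre) σ
        T-own   : 0 ℕ.< length pre → lookup (T σ) v ≡ ws
        t-kept  : ∀ {j} → toℕ j ℕ.< k → lookup (t σ) j ≡ lookup (t σ₀) j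
        o-kept  : ∀ {j} → toℕ j ℕ.< k → lookup (o σ) j ≡ lookup (o σ₀) j
        T-kept  : ∀ {j} → toℕ j ℕ.< k → lookup (T σ) j ≡ lookup (T σ₀) j
        s-kept  : ∀ {j} → suc (toℕ j) ℕ.< k → lookup (s σ) j ≡ lookup (s σ₀) j

    open Sweeping

    -- The acyclic orientations in which the sweep has passed at least pre.
    Passed : List (Fin n) → Matrix n → Set
    Passed pre D = LocallyAcyclic (Arc D) × AgreeBelow k (a σ₀) D × All (λ u → Directed side D u v) pre

    directed-below : ∀ {b c u w} → AgreeBelow (suc k) b c → u < v → w < v →
                     (Directed side b u v → Directed side c u v) × (Directed side b v w → Directed side c v w)
    directed-below bc u<v w<v =
      agree-directed side bc (m<n⇒m<1+n u<v) (n<1+n _) , agree-directed side bc (n<1+n _) (m<n⇒m<1+n w<v)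

    module _ (order : Order) where
      open Order order

      module _ {pre post : List (Fin n)} {σ : Store n} (eq : pre ++ post ≡ ws) (st : Sweeping pre post σ) where

        pre-earlier : ∀ {u} → u ∈ pre → EarlierNeighbour G v u
        pre-earlier = sound ∘ subst (_ ∈_) eq ∘ ∈-++⁺ˡ

        post-earlier : ∀ {u} → u ∈ post → EarlierNeighbour G v u
        post-earlier = sound ∘ subst (_ ∈_) eq ∘ ∈-++⁺ʳ pre

        pre-or-post : ∀ {u} → EarlierNeighbour G v u → u ∈ pre ⊎ u ∈ post
        pre-or-post = ∈-++⁻ pre ∘ subst (_ ∈_) (sym eq) ∘ complete

        extends⇒passed : ∀ {D} → Extends (suc k) (a σ) D → Passed pre D
        extends⇒passed (ac , agree) =
          ac , agree-trans (agrees st) (agree-≤ (n≤1+n k) agree) ,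
          All.tabulate λ u∈ → let u<v = proj₁ (pre-earlier u∈) in
            proj₁ (directed-below agree u<v u<v) (All.lookup (in-arcs st) u∈)

        -- Both orientations extend that of `σ₀` below `v`, and `pre` and `post` exhaust the arcs at
        -- `v`.
        passed⇒extends : ∀ {D} → Passed pre D → All (λ u → Directed side D v u) post → Extends (suc k) (a σ) D
        passed⇒extends (ac , agree , pre→v) v→post = ac ,
          agree-top G peo side (locallyAcyclic-directed G peo side (acyclic-arcs (resting st)))
                    (locallyAcyclic-directed G peo side ac) (agree-trans (agree-sym (agrees st)) agree)
            (λ u~v → [ (λ u∈ → inj₁ (All.lookup (in-arcs st) u∈ , All.lookup pre→v u∈))
                     , (λ u∈ → inj₂ (All.lookup (out-arcs st) u∈ , All.lookup v→post u∈)) ]′ (pre-or-post u~v))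

      sweep-end : ∀ {pre σ σ′} → pre ++ [] ≡ ws → Sweeping pre [] σ → Swept (suc k) v σ σ′ → Swept k f σ₀ σ′
      sweep-end {pre} {σ} {σ′} eq st sw = record
        { resting = record
          { acyclic-arcs = acyclic-arcs (resting sw)
          ; t≡0          = rest-t
          ; extremal     = rest-extremal
          }
        ; agrees = agree-trans (agrees st) (agree-≤ (n≤1+n k) (agrees sw))
        ; t-kept = λ j<k → trans (t-kept sw (m<n⇒m<1+n j<k)) (t-kept st j<k)
        ; o-kept = λ j<k → trans (o-kept sw (m<n⇒m<1+n j<k)) (o-kept st j<k)
        ; T-kept = λ j<k → trans (T-kept sw (m<n⇒m<1+n j<k)) (T-kept st j<k)
        ; s-last = trans (s-last sw) s-v
        ; s-own  = own
        ; s-kept = λ j<k → trans (s-kept sw (m<n⇒m<1+n j<k)) (s-kept st j<k)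
        }
        where
        t-v = proj₁ (status st)
        o-v = proj₁ (proj₂ (status st))
        s-v = proj₁ (proj₂ (proj₂ (status st)))
        s-f = proj₂ (proj₂ (proj₂ (status st)))
        rest-t : ∀ {j} → k ≤ toℕ j → lookup (t σ′) j ≡ 0
        rest-t {j} k≤j with m≤n⇒m<n∨m≡n k≤j
        ... | inj₁ k<j = t≡0 (resting sw) k<j
        ... | inj₂ k≡j with refl ← toℕ-injective {i = v} {j} k≡j = trans (t-kept sw (n<1+n k)) t-v
        rest-extremal : ∀ {j u} → k ≤ toℕ j → u < j → ¬ Directed (lookup (o σ′) j) (a σ′) u j
        rest-extremal {j} {u} k≤j u<j e with m≤n⇒m<n∨m≡n k≤j
        ... | inj₁ k<j = extremal (resting sw) k<j u<j e
        -- The turn has reversed the side of `v`, and in the reversed direction the end of this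
        -- sweep is the start of the next.
        ... | inj₂ k≡j with refl ← toℕ-injective {i = v} {j} k≡j = one-way ac′ v→u u→v
          where
          ac′ = locallyAcyclic-directed G peo side (acyclic-arcs (resting sw))
          v→u : Directed side (a σ′) v u
          v→u = directed-opposite side (subst (λ z → Directed z (a σ′) u v) (trans (o-kept sw (n<1+n k)) o-v) e)
          u∈pre : u ∈ pre
          u∈pre with pre-or-post eq st (u<j , ~-sym (arc⇒edge ac′ v→u))
          ... | inj₁ u∈ = u∈
          u→v : Directed side (a σ′) u v
          u→v = proj₁ (directed-below (agrees sw) u<j u<j) (All.lookup (in-arcs st) u∈pre)
        own : ∀ {j} → k ≤ suc (toℕ j) → j < last → lookup (s σ′) j ≡ j
        own {j} k≤j+1 j<last with m≤n⇒m<n∨m≡n k≤j+1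
        ... | inj₁ k<j+1 = s-own sw k<j+1 j<last
        -- The series above `v` restores `s` only from `v` on; the entry at `f` was reset by the
        -- turn of `v`.
        ... | inj₂ k≡j+1 with refl ← toℕ-injective {i = f} {j} (suc-injective (trans f+1≡v k≡j+1)) =
          trans (s-kept sw (ℕ.s≤s (≤-reflexive f+1≡v))) s-f

      -- Either the sweep passes x as well, or the arcs from v to the vertices after x follow
      -- from the arc v → x by coherence.
      passed-split : ∀ {pre x post σ} → pre ++ x ∷ post ≡ ws → Sweeping pre (x ∷ post) σ → ∀ {D} →
                     Passed pre D → Extends (suc k) (a σ) D ⊎ Passed (pre ∷ʳ x) D
      passed-split {pre} {x} {post} eq st {D} (ac , agree , pre→v) with directed? side D x v
      ... | yes x→v = inj₂ (ac , agree , All.∷ʳ⁺ pre→v x→v)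
      ... | no ¬x→v = inj₁ (passed⇒extends eq st (ac , agree , pre→v) (v→x ∷ All.tabulate v→post))
        where
        acᵈ = locallyAcyclic-directed G peo side ac
        x-earlier = post-earlier eq st (here refl)
        v→x : Directed side D v x
        v→x = directed-split G peo side acᵈ (proj₂ x-earlier) ¬x→v
        v→post : ∀ {y} → y ∈ post → Directed side D v y
        v→post y∈ with y-earlier ← post-earlier eq st (there y∈)
                     | allPairs-++⁻ʳ pre (subst (AllPairs _) (sym eq) chain)
        ... | x→post ∷ _ = directed-split G peo side acᵈ (proj₂ y-earlier) λ y→v →
          one-way acᵈ (agree-directed side agree (proj₁ x-earlier) (proj₁ y-earlier) (All.lookup x→post y∈))
                      (coherent acᵈ (proj₁ y-earlier) (proj₁ x-earlier) y→v v→x)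

      module Advance {pre x post σ σ₁} (eq : pre ++ x ∷ post ≡ ws) (st : Sweeping pre (x ∷ post) σ)
                     (sw : Swept (suc k) v σ σ₁) where

        -- ts are the orderings after the sorting step, which changes only T_v.
        record Orderings (ts : Vec (List (Fin n)) n) : Set where
          field
            own  : lookup ts v ≡ ws
            kept : ∀ {j} → toℕ j ℕ.< k → lookup ts j ≡ lookup (T σ₁) j

        next : Vec (List (Fin n)) n → Store n
        next ts = updated (null post) v f side (withFlipped v side (length pre) x (record σ₁ { T = ts }))

        private
          a₂ = flipped side (a σ₁) x v
          acˢ : LocallyAcyclic (Directed side (a σ₁))
          acˢ = locallyAcyclic-directed G peo side (acyclic-arcs (resting sw))
          x-earlier = post-earlier eq st (here refl)
          x<v = proj₁ x-earlier

          below≢v : ∀ {j : Fin n} → toℕ j ℕ.< k → j ≢ v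
          below≢v j<v refl = <-irrefl refl j<v

          above≢v : ∀ {j : Fin n} → k ℕ.< toℕ j → j ≢ v
          above≢v v<j refl = <-irrefl refl v<j

          agree₁ : AgreeBelow k (a σ₀) (a σ₁)
          agree₁ = agree-trans (agrees st) (agree-≤ (n≤1+n k) (agrees sw))

          a₂-agrees : AgreeBelow k (a σ₀) a₂
          a₂-agrees = agree-trans agree₁ (agreeing λ u<v w<v →
            sym (entry-flipped side (a σ₁) (below≢v w<v ∘ proj₂) (below≢v u<v ∘ proj₁)))

          v→x : Directed side (a σ₁) v x
          v→x = proj₂ (directed-below (agrees sw) x<v x<v) (All.lookup (out-arcs st) (here refl))

          chain-post : All (λ u → Directed side (a σ₀) x u) post
          chain-post with allPairs-++⁻ʳ pre (subst (AllPairs _) (sym eq) chain)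
          ... | x→post ∷ _ = x→post

          extremal₁ : ∀ {j u} → k ℕ.< toℕ j → u < j → ¬ Directed (lookup (o σ₁) j) (a σ₁) u j
          extremal₁ = extremal (resting sw)

          -- The side of `j` is independent of `side`: if they are equal no arc from below enters
          -- `j`, and if they are opposite no arc leaves it downwards.
          no-passage : ∀ {j u w} → v < j → u < j → w < j → Directed side (a σ₁) u j → ¬ Directed side (a σ₁) j w
          no-passage {j} v<j u<j w<j = case-side (lookup (o σ₁) j) side (extremal₁ v<j u<j) (extremal₁ v<j w<j)
            where
            case-side : ∀ o₁ o₂ {b u w} → ¬ Directed o₁ b u j → ¬ Directed o₁ b w j →
                        Directed o₂ b u j → ¬ Directed o₂ b j w
            case-side L L ¬u ¬w u→j j→w = ¬u u→j
            case-side L R ¬u ¬w u→j j→w = ¬w j→w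
            case-side R L ¬u ¬w u→j j→w = ¬w j→w
            case-side R R ¬u ¬w u→j j→w = ¬u u→j

          a₂-acyclic : LocallyAcyclic (Arc a₂)
          a₂-acyclic = locallyAcyclic-undirected G peo side
            (flipped-locallyAcyclic G peo side (a σ₁) acˢ x<v v→x first no-passage)
            where
            first : ∀ {w} → w < v → w ≢ x → Directed side (a σ₁) v w → Directed side (a σ₁) x w
            -- The arcs at `pre` already point to `v`, so `w` comes after `x` in the chain.
            first {w} w<v w≢x v→w with pre-or-post eq st (w<v , ~-sym (arc⇒edge acˢ v→w))
            ... | inj₁ w∈pre =
              ⊥-elim (one-way acˢ v→w
                (proj₁ (directed-below (agrees sw) w<v w<v) (All.lookup (in-arcs st) w∈pre)))
            ... | inj₂ (here w≡x) = ⊥-elim (w≢x w≡x)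
            ... | inj₂ (there w∈post) = agree-directed side agree₁ x<v w<v (All.lookup chain-post w∈post)

          a₂-extremal : ∀ {j u} → k ℕ.< toℕ j → u < j → ¬ Directed (lookup (o σ₁) j) a₂ u j
          a₂-extremal {j} {u} v<j u<j e = extremal₁ v<j u<j (directed-≡ (lookup (o σ₁) j)
            (entry-flipped side (a σ₁) (above≢v v<j ∘ proj₂) λ { (_ , refl) → <-asym x<v v<j })
            (entry-flipped side (a σ₁) (λ { (refl , _) → <-asym x<v v<j }) (above≢v v<j ∘ proj₁)) e)

          a₂-before : All (λ u → Directed side a₂ u v) (pre ∷ʳ x)
          a₂-before = All.∷ʳ⁺ (All.tabulate λ {u} u∈ → let u<v = proj₁ (pre-earlier eq st u∈) in
              flipped-keeps′ u<v (proj₁ (directed-below (agrees sw) u<v u<v) (All.lookup (in-arcs st) u∈)))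
            (flipped-arc side (a σ₁) λ { refl → <-irrefl refl x<v })
            where
            flipped-keeps′ : ∀ {u} → u < v → Directed side (a σ₁) u v → Directed side a₂ u v
            flipped-keeps′ {u} u<v u→v with u ≟ᶠ x
            ... | yes refl = ⊥-elim (one-way acˢ v→x u→v)
            ... | no u≢x   = flipped-keeps side (a σ₁) (u≢x ∘ proj₁) (below≢v u<v ∘ proj₁) u→v

          a₂-after : All (λ u → Directed side a₂ v u) post
          a₂-after = All.tabulate λ {u} u∈ → let u<v = proj₁ (post-earlier eq st (there u∈)) in
            flipped-keeps side (a σ₁) (below≢v u<v ∘ proj₂) (x-not-after u∈ ∘ proj₂)
              (proj₂ (directed-below (agrees sw) u<v u<v) (All.lookup (out-arcs st) (there u∈)))
            where
            x-not-after : ∀ {u} → u ∈ post → u ≢ x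
            x-not-after u∈ refl = arc-irrefl acˢ (agree-directed side agree₁ x<v x<v (All.lookup chain-post u∈))

          s₂ = s σ₁ [ last ]≔ last

          below-last : ∀ {j : Fin n} → j ≢ last → j < last
          below-last {j} j≢last = ≤∧≢⇒< (≤fromℕ j) (j≢last ∘ toℕ-injective)

          -- `s-own` leaves out the last vertex, whose entry has just served to select `v`; the
          -- assignment of n to s_n in the update restores it.
          s₂-own : ∀ {j} → k ≤ toℕ j → lookup s₂ j ≡ j
          s₂-own {j} k≤j with j ≟ᶠ last
          ... | yes refl = lookup∘update last (s σ₁) last
          ... | no j≢last = trans (lookup∘update′ j≢last (s σ₁) last) (s-own sw (ℕ.s≤s k≤j) (below-last j≢last))

          s₂-kept : ∀ {j} → toℕ j ℕ.< k → lookup s₂ j ≡ lookup (s σ) j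
          s₂-kept {j} j<k = trans (lookup∘update′ j≢last (s σ₁) last) (s-kept sw (ℕ.s≤s j<k))
            where
            j≢last : j ≢ last
            j≢last refl = <⇒≱ j<k (≤fromℕ v)

          f<v : toℕ f ℕ.< k
          f<v = ≤-reflexive f+1≡v

          length-∷ʳ : length (pre ∷ʳ x) ≡ suc (length pre)
          length-∷ʳ = trans (length-++ pre) (+-comm (length pre) 1)

          o-v₁ : lookup (o σ₁) v ≡ side
          o-v₁ = trans (o-kept sw (n<1+n k)) (proj₁ (proj₂ (status st)))

          s₂-f : lookup s₂ f ≡ lookup (s σ₀) f
          s₂-f = trans (s₂-kept f<v) (proj₂ (proj₂ (proj₂ (status st))))

          turned : ∀ {A : Set} (xs : Vec A n) {y j} → j ≢ v → lookup (xs [ v ]≔ y) j ≡ lookup xs j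
          turned xs j≢v = lookup∘update′ j≢v xs _

          f≢v : f ≢ v
          f≢v = below≢v f<v

          t-kept₁ : ∀ {j} → toℕ j ℕ.< k → lookup (t σ₁) j ≡ lookup (t σ₀) j
          t-kept₁ j<v = trans (t-kept sw (m<n⇒m<1+n j<v)) (t-kept st j<v)

          o-kept₁ : ∀ {j} → toℕ j ℕ.< k → lookup (o σ₁) j ≡ lookup (o σ₀) j
          o-kept₁ j<v = trans (o-kept sw (m<n⇒m<1+n j<v)) (o-kept st j<v)

          T-kept₁ : ∀ {j} → toℕ j ℕ.< k → lookup (T σ₁) j ≡ lookup (T σ₀) j
          T-kept₁ j<v = trans (T-kept sw (m<n⇒m<1+n j<v)) (T-kept st j<v)

          advance-with : ∀ {ts} b → null post ≡ b → Orderings ts → Sweeping (pre ∷ʳ x) post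
            (updated b v f side (withFlipped v side (length pre) x (record σ₁ { T = ts })))
          advance-with false null≡ ord = record
            { resting = record
              { acyclic-arcs = a₂-acyclic
              ; t≡0          = λ v<j → trans (turned (t σ₁) (above≢v v<j)) (t≡0 (resting sw) v<j)
              ; extremal     = a₂-extremal
              }
            ; focused = λ v<j → s₂-own (<⇒≤ v<j)
            ; agrees  = a₂-agrees
            ; in-arcs = a₂-before
            ; out-arcs = a₂-after
            ; status  = subst (λ b → Status b _ _) (sym null≡)
                (trans (lookup∘update v (t σ₁) _) (sym length-∷ʳ) , o-v₁ , s₂-own ≤-refl , s₂-f)
            ; T-own   = λ _ → Orderings.own ord
            ; t-kept  = λ j<v → trans (turned (t σ₁) (below≢v j<v)) (t-kept₁ j<v)
            ; o-kept  = o-kept₁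
            ; T-kept  = λ j<v → trans (Orderings.kept ord j<v) (T-kept₁ j<v)
            ; s-kept  = λ j+1<v → trans (s₂-kept (<⇒≤ j+1<v)) (s-kept st j+1<v)
            }
          advance-with true null≡ ord = record
            { resting = record
              { acyclic-arcs = a₂-acyclic
              ; t≡0          = λ v<j → trans (trans (turned (t σ₁ [ v ]≔ _) (above≢v v<j))
                                                    (turned (t σ₁) (above≢v v<j))) (t≡0 (resting sw) v<j)
              ; extremal     = λ v<j u<j → a₂-extremal v<j u<j ∘
                  subst (λ z → Directed z a₂ _ _) (turned (o σ₁) (above≢v v<j))
              }
            ; focused = λ v<j → trans (lookup∘update′ (λ { refl → <-asym v<j f<v }) (s₂ [ v ]≔ _) _)
                                (trans (turned s₂ (above≢v v<j)) (s₂-own (<⇒≤ v<j)))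
            ; agrees  = a₂-agrees
            ; in-arcs = a₂-before
            ; out-arcs = a₂-after
            ; status  = subst (λ b → Status b _ _) (sym null≡)
                ( lookup∘update v (t σ₁ [ v ]≔ _) 0 , lookup∘update v (o σ₁) _
                , trans (lookup∘update′ (f≢v ∘ sym) (s₂ [ v ]≔ _) f) (trans (lookup∘update v s₂ _) s₂-f)
                , lookup∘update f (s₂ [ v ]≔ _) f)
            ; T-own   = λ _ → Orderings.own ord
            ; t-kept  = λ j<v → trans (turned (t σ₁ [ v ]≔ _) (below≢v j<v))
                (trans (turned (t σ₁) (below≢v j<v)) (t-kept₁ j<v))
            ; o-kept  = λ j<v → trans (turned (o σ₁) (below≢v j<v)) (o-kept₁ j<v)
            ; T-kept  = λ j<v → trans (Orderings.kept ord j<v) (T-kept₁ j<v)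
            ; s-kept  = λ j+1<v → trans (lookup∘update′ (λ { refl → <-irrefl f+1≡v j+1<v }) (s₂ [ v ]≔ _) f)
                (trans (turned s₂ (below≢v (<⇒≤ j+1<v))) (trans (s₂-kept (<⇒≤ j+1<v)) (s-kept st j+1<v)))
            }

        advance : ∀ {ts} → Orderings ts → Sweeping (pre ∷ʳ x) post (next ts)
        advance = advance-with (null post) refl

-- Executing the sweeps and accounting for the sorting

allPairs-map : ∀ {A : Set} {P : A → Set} {_≺_ _⊏_ : A → A → Set} →
               (∀ {x y} → P x → P y → x ≺ y → x ⊏ y) →
               ∀ {xs} → All P xs → AllPairs _≺_ xs → AllPairs _⊏_ xs
allPairs-map f []       []       = []
allPairs-map f (p ∷ ps) (r ∷ rs) = All.zipWith (λ (q , x≺y) → f p q x≺y) (ps , r) ∷ allPairs-map f ps rs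

allPairs-reverse : ∀ {A : Set} {_≺_ : A → A → Set} {xs} → AllPairs _≺_ xs → AllPairs (flip _≺_) (reverse xs)
allPairs-reverse [] = []
allPairs-reverse {xs = x ∷ xs} (px ∷ ps) rewrite unfold-reverse x xs =
  AllPairs.++⁺ (allPairs-reverse ps) ([] ∷ []) (All.map (_∷ []) (All-resp-↭ (↭-sym (↭-reverse xs)) px))

from-does : ∀ {P : Set} (P? : Dec P) → does P? ≡ true → P
from-does (yes p) _  = p
from-does (no _)  ()

Generates : SortingAlgorithm → ∀ {m} → Graph (suc m) → ℕ → Set
Generates S G K = ∃[ Ds ] ∃[ τ ]
  ( AlgorithmA.Run S G (initial G) Ds τ
  × Unique Ds
  × (∀ D → D ∈ Ds ⇔ IsAcyclicOrientation G D)
  × τ ≤ K * length Ds )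

generates-mono : ∀ S {m} (G : Graph (suc m)) {K K′} → K ≤ K′ → Generates S G K → Generates S G K′
generates-mono S G K≤K′ (Ds , τ , run , unique , exact , τ≤) =
  Ds , τ , run , unique , exact , ≤-trans τ≤ (*-monoˡ-≤ (length Ds) K≤K′)

-- Reading N_j, sorting it and writing T_j.
sortCost : ℕ → ℕ → ℕ
sortCost c d = d + d + c * (1 + d * ⌊log₂ d ⌋)

-- A round and its visit take at most 27 units apart from the sorting, and each flip of an arc at j
-- additionally pays κ towards the sorting of N_j at the start of its sweep.
module Generation (S : SortingAlgorithm) {m : ℕ} (G : Graph (suc m)) (peo : PerfectEliminationOrder G)
  (connected : Connected G) (κ : ℕ)
  (sort-paid : ∀ j → 1 ≤ length (earlierNeighbours G j) →
               sortCost (SortingAlgorithm.constant S) (length (earlierNeighbours G j)) ≤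
               length (earlierNeighbours G j) * κ) where

  open Graph G
  open AlgorithmA S G
  open SortingAlgorithm S
  open LocalAcyclicity G peo
  open LocallyAcyclic
  open Execution S G
  open Coverage S G (27 + κ)
  open Invariants S G peo (27 + κ)
  open Resting
  open Swept

  private
    n = suc m

  ∈N⇒ : ∀ {j u} → u ∈ N j → EarlierNeighbour G j u
  ∈N⇒ {j} = proj₂ ∘ ∈-filter⁻ (earlierNeighbour? G j)

  ⇒∈N : ∀ {j u} → EarlierNeighbour G j u → u ∈ N j
  ⇒∈N {j} = ∈-filter⁺ (earlierNeighbour? G j) (∈-allFin _)

  entry-initial : ∀ u w → entry (a (initial G)) u w ≡ does (earlierNeighbour? G w u)
  entry-initial u w = trans (cong (λ row → lookup row w)
                                   (lookup∘tabulate (λ u → tabulate λ w → does (earlierNeighbour? G w u)) u))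
                           (lookup∘tabulate (λ w → does (earlierNeighbour? G w u)) w)

  N-strictTotal : ∀ {b} j → LocallyAcyclic (Arc b) → StrictTotalOn (Arc b) (N j)
  N-strictTotal {b} j ac = record { trans = tr ; compare = cmp }
    where
    edge : ∀ {u w} → u ∈ N j → w ∈ N j → u ≢ w → u ~ w
    edge u∈ w∈ = peo j (∈N⇒ u∈) (∈N⇒ w∈)
    tr : ∀ {u v w} → u ∈ N j → v ∈ N j → w ∈ N j → Arc b u v → Arc b v w → Arc b u w
    tr {u} {v} {w} u∈ v∈ w∈ u→v v→w with u ≟ᶠ w
    ... | yes refl = ⊥-elim (one-way ac u→v v→w)
    ... | no u≢w   = transitive ac (edge u∈ w∈ u≢w) u→v v→w
    cmp : ∀ {u w} → u ∈ N j → w ∈ N j → Tri (Arc b u w) (u ≡ w) (Arc b w u)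
    cmp {u} {w} u∈ w∈ with u ≟ᶠ w
    ... | yes refl = tri≈ (arc-irrefl ac) refl (arc-irrefl ac)
    ... | no u≢w with edge⇒arc ac (edge u∈ w∈ u≢w)
    ...   | inj₁ u→w = tri< u→w u≢w (one-way ac u→w)
    ...   | inj₂ w→u = tri> (one-way ac w→u) u≢w w→u

  module _ {σ} (j : Fin n) (side : Side) (ac : LocallyAcyclic (Arc (a σ))) where

    private
      vs = value (sortResult j σ)

      vs-sorted : vs ↭ N j × AllPairs (Arc (a σ)) vs
      vs-sorted = sorts _ (N j)
        (Unique.filter⁺ (earlierNeighbour? G j) (Unique.allFin⁺ n))
        (N-strictTotal {a σ} j ac)

    sorted-↭ : sorted side vs ↭ N j
    sorted-↭ = ↭-trans (unsort side) (proj₁ vs-sorted)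
      where
      unsort : ∀ side → sorted side vs ↭ vs
      unsort L = ↭-reverse vs
      unsort R = ↭-refl

    sorted-chain : AllPairs (Directed side (a σ)) (sorted side vs)
    sorted-chain = chain side
      where
      chain : ∀ side → AllPairs (Directed side (a σ)) (sorted side vs)
      chain L = allPairs-reverse (proj₂ vs-sorted)
      chain R = proj₂ vs-sorted

  updateTime≤11 : ∀ b → updateTime b ≤ 11
  updateTime≤11 false = m≤m+n 4 7
  updateTime≤11 true  = ≤-refl

  -- The comparison of the incremented t_j with |N_j| detects the last flip of the sweep.
  turn-test : ∀ {A : Set} (xs : List A) {y} ys → (suc (length xs) ≡ᵇ length (xs ++ y ∷ ys)) ≡ null ys
  turn-test []       []      = refl
  turn-test []       (_ ∷ _) = refl
  turn-test (_ ∷ xs) ys      = turn-test xs ys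

  module _ (i : Fin m) {σ₀ : Store n} {ws : List (Fin n)} (order : Sweep.Order i σ₀ ws) where
    open Sweep i σ₀ ws
    open Sweeping
    open Order order

    turn-test-N : ∀ {pre x post} (ts : Vec ℕ n) → pre ++ x ∷ post ≡ ws →
                  (lookup (ts [ v ]≔ suc (length pre)) v ≡ᵇ length (N v)) ≡ null post
    turn-test-N {pre} {x} {post} ts eq = trans
      (cong₂ _≡ᵇ_ (lookup∘update v ts _) (trans (sym count) (cong length (sym eq)))) (turn-test pre post)

    sweep-join : ∀ {pre x post σ σ₁ ts τ credit σ′} (eq : pre ++ x ∷ post ≡ ws) (st : Sweeping pre (x ∷ post) σ)
      (sw : Swept (suc k) v σ σ₁) → Cover (Extends (suc k) (a σ)) 0 σ σ₁ →
      round σ₁ ≡ ((go-back , Advance.next order eq st sw ts) after τ) →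
      Cover (Passed (pre ∷ʳ x)) (length post * κ) (Advance.next order eq st sw ts) σ′ →
      suc τ + credit ≤ 27 + κ + length post * κ →
      Cover (Passed pre) credit σ σ′
    sweep-join {pre} {x} eq st sw c round≡ c′ time≤ = cover-join c round≡ c′ time≤
      -- Disjointness: extensions of the present orientation have the arc from `v` to `x`, those
      -- that have passed `x` the reverse arc.
      (λ (_ , agree) (ac , _ , pre,x→v) →
        one-way (locallyAcyclic-directed G peo side ac) (proj₂ (All.∷ʳ⁻ pre,x→v))
          (proj₂ (directed-below agree x<v x<v) (All.lookup (out-arcs st) (here refl))))
      (extends⇒passed order eq st)
      (λ (ac , agree , pre,x→v) → ac , agree , proj₁ (All.∷ʳ⁻ pre,x→v))
      (passed-split order eq st)
      where x<v = proj₁ (post-earlier order eq st (here refl))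

    -- The list of passed vertices is non-empty because the first flip, which includes the sorting,
    -- is left to `phase-step`; from then on T_v is known to be `ws`.
    sweep : Phase (suc k) v → ∀ p pre post {σ} → p ∷ pre ++ post ≡ ws → Sweeping (p ∷ pre) post σ →
            ∃[ σ′ ] (Swept k f σ₀ σ′ × Cover (Passed (p ∷ pre)) (length post * κ) σ σ′)
    sweep phase p pre [] eq st with phase (resting st) (focused st)
    ... | σ′ , sw , c = σ′ , sweep-end order eq st sw ,
      cover-map (extends⇒passed order eq st) (λ passed → passed⇒extends order eq st passed []) c
    sweep phase p pre (x ∷ post) {σ} eq st with phase (resting st) (focused st)
    ... | σ₁ , sw , c with sweep phase p (pre ∷ʳ x) post (trans (cong (p ∷_) (++-assoc pre (x ∷ []) post)) eq)
                             (Advance.advance order eq st sw {T σ₁} record { own = own-T ; kept = λ _ → refl })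
      where
      own-T : lookup (T σ₁) v ≡ ws
      own-T = trans (T-kept sw (n<1+n k)) (T-own st ℕ.z<s)
    ...   | σ′ , sw′ , c′ = σ′ , sw′ , sweep-join {ts = T σ₁} eq st sw c
      (round-≡ {σ = σ₁} (trans (s-last sw) (proj₁ (proj₂ (proj₂ (status st)))))
        (process-idle {σ = σ₁} i (trans (t-kept sw (n<1+n k)) (proj₁ (status st)))
          (trans (o-kept sw (n<1+n k)) (proj₁ (proj₂ (status st))))
          (trans (cong (head ∘ drop (suc (length pre)))
                             (trans (T-kept sw (n<1+n k)) (trans (T-own st ℕ.z<s) (sym eq))))
                 (head-drop-++ (p ∷ pre)))
          (turn-test-N {p ∷ pre} {x} {post} (t σ₁) eq)))
      c′ time≤
      where
      -- The visit takes 1 unit, the selection 2 and the processing at most 11 + 11, together 25; κ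
      -- of the allowance of this visit goes into the credit.
      time≤ : suc (2 + (11 + (updateTime (null post) + 0))) + suc (length post) * κ ≤ 27 + κ + length post * κ
      time≤ = begin
        14 + (updateTime (null post) + 0) + (κ + length post * κ)
          ≤⟨ +-monoˡ-≤ (κ + length post * κ) (+-monoʳ-≤ 14 (+-monoˡ-≤ 0 (updateTime≤11 (null post)))) ⟩
        25 + (κ + length post * κ)
          ≤⟨ +-monoˡ-≤ (κ + length post * κ) (m≤m+n 25 2) ⟩
        27 + (κ + length post * κ)
          ≡⟨ +-assoc 27 κ (length post * κ) ⟨
        27 + κ + length post * κ ∎
        where open ≤-Reasoning

  resting-≤ : ∀ {k l σ} → k ≤ l → Resting k σ → Resting l σ
  resting-≤ k≤l rest = record
    { acyclic-arcs = acyclic-arcs rest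
    ; t≡0          = λ l≤j → t≡0 rest (≤-trans k≤l l≤j)
    ; extremal     = λ l≤j → extremal rest (≤-trans k≤l l≤j)
    }

  -- The first series of sweeps above is run before `Sweep` is instantiated, since `ws` is the
  -- outcome of a sort that takes place only in `σ₁`.
  phase-step : ∀ i → Phase (suc (toℕ (suc i))) (suc i) → Phase (toℕ (suc i)) (inject₁ i)
  phase-step i phase {σ₀} rest focus with phase {σ₀} (resting-≤ (n≤1+n _) rest) (λ k<j → focus (<⇒≤ k<j))
  ... | σ₁ , sw , c = result (sorted side (value (sortResult (suc i) σ₁))) refl
    where
    j = suc i
    side = lookup (o σ₀) j
    ac₁ = acyclic-arcs (resting sw)
    ts = T (withSorted j side σ₁)

    result : ∀ ws → sorted side (value (sortResult j σ₁)) ≡ ws →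
             ∃[ σ′ ] (Swept (toℕ j) (inject₁ i) σ₀ σ′ × Cover (Extends (toℕ j) (a σ₀)) 0 σ₀ σ′)
    -- Connectedness excludes an empty N_j, for which there would be no first flip.
    result [] ws≡ with hasEarlierNeighbour connected {zero} {j} ℕ.z<s
    ... | _ , earlier
      with () ← subst (_ ∈_) ws≡ (∈-resp-↭ (↭-sym (sorted-↭ {σ₁} j side ac₁)) (⇒∈N earlier))
    result (x ∷ post) ws≡ = swept
      (sweep i order phase x [] post refl (Advance.advance order refl st sw {ts} orderings))
      where
      open Sweep i σ₀ (x ∷ post) using (Order; Sweeping; Passed; k; v; f; module Advance)

      ws↭N : x ∷ post ↭ N j
      ws↭N = subst (_↭ N j) ws≡ (sorted-↭ {σ₁} j side ac₁)

      order : Order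
      order .Order.sound    = ∈N⇒ ∘ ∈-resp-↭ ws↭N
      order .Order.complete = ∈-resp-↭ (↭-sym ws↭N) ∘ ⇒∈N
      order .Order.count    = ↭-length ws↭N
      order .Order.chain    = allPairs-map
        (λ { (u<j , _) (w<j , _) →
          agree-directed side (agree-sym (agrees sw)) (m<n⇒m<1+n u<j) (m<n⇒m<1+n w<j) })
        (All.tabulate (λ u∈ → Order.sound order u∈))
        (subst (AllPairs (Directed side (a σ₁))) ws≡ (sorted-chain {σ₁} j side ac₁))

      st : Sweeping [] (x ∷ post) σ₀
      st = record
        { resting  = resting-≤ (n≤1+n k) rest
        ; focused  = λ k<j → focus (<⇒≤ k<j)
        ; agrees   = agree-refl
        ; in-arcs  = []
        ; out-arcs = All.tabulate λ u∈ → let u<v , u~v = Order.sound order u∈ in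
                       directed-split G peo side (locallyAcyclic-directed G peo side (acyclic-arcs rest)) u~v
                                      (extremal rest ≤-refl u<v)
        ; status   = t≡0 rest ≤-refl , refl , focus ≤-refl , refl
        ; T-own    = λ ()
        ; t-kept   = λ _ → refl
        ; o-kept   = λ _ → refl
        ; T-kept   = λ _ → refl
        ; s-kept   = λ _ → refl
        }

      own-T : lookup ts j ≡ x ∷ post
      own-T = trans (lookup∘update j (T σ₁) _) ws≡

      orderings : Advance.Orderings order refl st sw ts
      orderings = record
        { own  = own-T
        ; kept = λ u<v → lookup∘update′ (λ { refl → <-irrefl refl u<v }) (T σ₁) _
        }

      d = length (N j)
      ℓ = length (sorted side (value (sortResult j σ₁)))
      τ = time (sortResult j σ₁)
      u = updateTime (null post)

      -- The fixed costs are 1 for the visit, 2 for the selection, 2 + 2 for `t` and `o`, 9 around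
      -- the flip and at most 11 for the update, which gives the 27. The rest is `sortCost`, met by
      -- the κ of this visit and the credit of the remaining flips.
      time≤ : suc (2 + (2 + (d + 0 + (τ + (2 + ℓ))) + (9 + (u + 0)))) + 0 ≤ 27 + κ + length post * κ
      time≤ = begin
        suc (2 + (2 + (d + 0 + (τ + (2 + ℓ))) + (9 + (u + 0)))) + 0
          ≡⟨ solve 4 (λ d τ ℓ u → con 3 :+ (con 2 :+ (d :+ con 0 :+ (τ :+ (con 2 :+ ℓ))) :+ (con 9 :+
                                  (u :+ con 0))) :+ con 0 := con 16 :+ u :+ (d :+ ℓ :+ τ)) refl d τ ℓ u ⟩
        16 + u + (d + ℓ + τ)
          ≤⟨ +-mono-≤ (+-monoʳ-≤ 16 (updateTime≤11 (null post)))
               (+-mono-≤ (+-monoʳ-≤ d (≤-reflexive (↭-length (sorted-↭ {σ₁} j side ac₁))))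
                           (fast _ (N j) λ _ _ → ≤-refl)) ⟩
        27 + (d + d + constant * (1 + d * ⌊log₂ d ⌋))
          ≤⟨ +-monoʳ-≤ 27 (sort-paid j (subst (1 ≤_) (↭-length ws↭N) ℕ.z<s)) ⟩
        27 + d * κ
          ≡⟨ cong (λ d → 27 + d * κ) (↭-length ws↭N) ⟨
        27 + (κ + length post * κ)
          ≡⟨ +-assoc 27 κ (length post * κ) ⟨
        27 + κ + length post * κ ∎
        where open ≤-Reasoning
              open +-*-Solver

      swept : ∃[ σ′ ] (Swept k f σ₀ σ′ × Cover (Passed (x ∷ [])) (length post * κ) _ σ′) →
              ∃[ σ′ ] (Swept k f σ₀ σ′ × Cover (Extends k (a σ₀)) 0 σ₀ σ′)
      swept (σ′ , sw′ , c′) = σ′ , sw′ ,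
        cover-map (λ (ac , agree , _) → ac , agree) (λ (ac , agree) → ac , agree , [])
          (sweep-join i order {ts = ts} refl st sw c
            (round-≡ {σ = σ₁} (trans (s-last sw) (focus ≤-refl))
              (process-sort {σ = σ₁} i (trans (t-kept sw (n<1+n k)) (t≡0 rest ≤-refl)) (o-kept sw (n<1+n k))
                (cong head own-T) (turn-test-N i order {[]} {x} {post} (t σ₁) refl)))
            c′ time≤)

  phase : ∀ f → Phase (suc (toℕ f)) f
  phase = >-weakInduction (λ f → Phase (suc (toℕ f)) f)
    (subst (λ k → Phase (suc k) last) (sym (toℕ-fromℕ m)) phase-last)
    (λ i below → subst (λ k → Phase (suc k) (inject₁ i)) (sym (toℕ-inject₁ i)) (phase-step i below))

  initial-arc : ∀ {u w} → Arc (a (initial G)) u w → EarlierNeighbour G w u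
  initial-arc {u} {w} arc = from-does (earlierNeighbour? G w u) (trans (sym (entry-initial u w)) arc)

  initial-edge : ∀ {u w} → EarlierNeighbour G w u → Arc (a (initial G)) u w
  initial-edge {u} {w} u~w = trans (entry-initial u w) (dec-true (earlierNeighbour? G w u) u~w)

  initial-resting : Resting 1 (initial G)
  initial-resting = record
    { acyclic-arcs = record
      { arc⇒edge = proj₂ ∘ initial-arc
      ; edge⇒arc = edge⇒arc₀
      ; one-way  = λ {u} {w} u→w w→u →
          <-asym (proj₁ (initial-arc {u} {w} u→w)) (proj₁ (initial-arc {w} {u} w→u))
      ; coherent = λ {u} {v} {w} u<v w<v u→v v→w → ⊥-elim (<-asym w<v (proj₁ (initial-arc {v} {w} v→w)))
      }
    ; t≡0      = λ {j} _ → lookup-replicate j 0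
    ; extremal = λ {j} {u} _ u<j → subst (λ z → ¬ Directed z (a (initial G)) u j) (sym (lookup-replicate j L))
                   (λ j→u → <-asym u<j (proj₁ (initial-arc {j} {u} j→u)))
    }
    where
    edge⇒arc₀ : ∀ {u w} → u ~ w → Arc (a (initial G)) u w ⊎ Arc (a (initial G)) w u
    edge⇒arc₀ {u} {w} u~w with <-cmp u w
    ... | tri< u<w _ _ = inj₁ (initial-edge (u<w , u~w))
    ... | tri≈ _ u≡w _ = ⊥-elim (~-irrefl u≡w u~w)
    ... | tri> _ _ w<u = inj₂ (initial-edge (w<u , ~-sym u~w))

  -- With only one vertex below 1 there are no arcs to compare, so the phase above the first vertex
  -- covers every acyclic orientation.
  extends-any : ∀ b D → LocallyAcyclic (Arc b) → LocallyAcyclic (Arc D) → AgreeBelow 1 b D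
  extends-any b D acb acd .AgreeBelow.agree {zero} {zero} _ _ =
    true-ext (⊥-elim ∘ arc-irrefl acb) (⊥-elim ∘ arc-irrefl acd)
  extends-any b D acb acd .AgreeBelow.agree {suc _} (ℕ.s≤s ()) _
  extends-any b D acb acd .AgreeBelow.agree {zero} {suc _} _ (ℕ.s≤s ())

  generates : Generates S G (27 + κ)
  generates with phase zero {initial G} initial-resting (λ {j} _ → lookup-allFin j)
  ... | σ , sw , c = visited , _ , segment-run segment (round-≡ {σ = σ} (s-last sw) refl) , unique ,
    (λ D → mk⇔ (λ D∈ → locallyAcyclic⇒acyclicOrientation D (proj₁ (sound D∈)))
      (λ ao → let ac = acyclicOrientation⇒locallyAcyclic D ao in
              complete (ac , extends-any _ D (acyclic-arcs initial-resting) ac))) ,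
    time≤
    where
    open Cover c
    -- The 3 units are the last visit and the selection that leads to termination; the allowance of
    -- the last visit, which is not in `left`, pays for them.
    time≤ : duration + 3 ≤ (27 + κ) * length visited
    time≤ = begin
      duration + 3
        ≤⟨ +-mono-≤ (≤-trans (m≤m+n duration 0) amortised) (m≤m+n 3 (24 + κ)) ⟩
      (27 + κ) * length left + (27 + κ)
        ≡⟨ +-comm _ (27 + κ) ⟩
      (27 + κ) + (27 + κ) * length left
        ≡⟨ *-suc (27 + κ) (length left) ⟨
      (27 + κ) * suc (length left)
        ≡⟨ cong ((27 + κ) *_) (trans (length-++ left) (+-comm (length left) 1)) ⟨
      (27 + κ) * length visited ∎
      where open ≤-Reasoning

-- The clique number and the final constant

length-filter≡size : ∀ {A : Set} {P : Pred A 0ℓ} (P? : Decidable P) {n} (f : Fin n → A) →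
                     length (filter P? (List.tabulate f)) ≡ ∣ tabulate (does ∘ P? ∘ f) ∣
length-filter≡size P? {zero}  f = refl
length-filter≡size P? {suc n} f with does (P? (f zero))
... | true  = cong suc (length-filter≡size P? (f ∘ suc))
... | false = length-filter≡size P? (f ∘ suc)

earlierNeighbours≤cliqueNumber : ∀ {n ω} (G : Graph n) → PerfectEliminationOrder G → IsCliqueNumber G ω →
                                 ∀ j → length (earlierNeighbours G j) ≤ ω
earlierNeighbours≤cliqueNumber {n} {ω} G peo (_ , bound) j =
  subst (_≤ ω) (sym (length-filter≡size (earlierNeighbour? G j) (λ i → i)))
        (bound N λ u∈ w∈ → peo j (earlier u∈) (earlier w∈))
  where
  N = tabulate (does ∘ earlierNeighbour? G j)
  earlier : ∀ {u} → u ∈ˢ N → EarlierNeighbour G j u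
  earlier {u} u∈ = from-does (earlierNeighbour? G j u) (trans (sym (lookup∘tabulate _ u)) ([]=⇒lookup u∈))

-- The terms d, d, 1 and d log d, the last two with factor `c`, are each at most dℓ; for the 1 this
-- is where d ≥ 1 enters.
sortCost-≤ : ∀ c {d ω} → 1 ≤ d → d ≤ ω →
             sortCost c d ≤ d * ((2 + 2 * c) * (1 ⊔ ⌊log₂ ω ⌋))
sortCost-≤ c {d} {ω} 1≤d d≤ω = begin
  d + d + c * (1 + d * ⌊log₂ d ⌋)
    ≤⟨ +-mono-≤ (+-mono-≤ d≤dℓ d≤dℓ) (*-monoʳ-≤ c (+-mono-≤ (≤-trans 1≤d d≤dℓ) (*-monoʳ-≤ d log≤ℓ))) ⟩
  d * ℓ + d * ℓ + c * (d * ℓ + d * ℓ)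
    ≡⟨ solve 3 (λ c d ℓ → d :* ℓ :+ d :* ℓ :+ c :* (d :* ℓ :+ d :* ℓ) :=
                        d :* ((con 2 :+ con 2 :* c) :* ℓ)) refl c d ℓ ⟩
  d * ((2 + 2 * c) * ℓ) ∎
  where
  open ≤-Reasoning
  open +-*-Solver
  ℓ = 1 ⊔ ⌊log₂ ω ⌋
  log≤ℓ : ⌊log₂ d ⌋ ≤ ℓ
  log≤ℓ = ≤-trans (⌊log₂⌋-mono-≤ d≤ω) (m≤n⊔m 1 ⌊log₂ ω ⌋)
  d≤dℓ : d ≤ d * ℓ
  d≤dℓ = subst (_≤ d * ℓ) (*-identityʳ d) (*-monoʳ-≤ d (m≤m⊔n 1 ⌊log₂ ω ⌋))

theorem7 : (S : SortingAlgorithm) →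
    ∃[ C ] (∀ {m : ℕ} (G : Graph (suc m)) (ω : ℕ) →
    Connected G → Chordal G → PerfectEliminationOrder G → IsCliqueNumber G ω →
    ∃[ Ds ] ∃[ τ ]
    ( AlgorithmA.Run S G (initial G) Ds τ
    × Unique Ds
    × (∀ D → D ∈ Ds ⇔ IsAcyclicOrientation G D)
    × τ ≤ C * (1 ⊔ ⌊log₂ ω ⌋) * length Ds ))
theorem7 S = 27 + (2 + 2 * c) , λ G ω connected _ peo cliqueNumber →
  -- κ is the factor of d in `sortCost-≤`. The maximum with 1 keeps ℓ positive even for ω = 1, so
  -- that the fixed 27 units are also at most a multiple of ℓ.
  generates-mono S G (constant≤ ω) (Generation.generates S G peo connected ((2 + 2 * c) * (1 ⊔ ⌊log₂ ω ⌋))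
    λ j 1≤d → sortCost-≤ c 1≤d (earlierNeighbours≤cliqueNumber G peo cliqueNumber j))
  where
  c = SortingAlgorithm.constant S
  constant≤ : ∀ ω → 27 + (2 + 2 * c) * (1 ⊔ ⌊log₂ ω ⌋) ≤ (27 + (2 + 2 * c)) * (1 ⊔ ⌊log₂ ω ⌋)
  constant≤ ω = begin
    27 + (2 + 2 * c) * ℓ      ≤⟨ +-monoˡ-≤ ((2 + 2 * c) * ℓ) (*-monoʳ-≤ 27 (m≤m⊔n 1 ⌊log₂ ω ⌋)) ⟩
    27 * ℓ + (2 + 2 * c) * ℓ  ≡⟨ *-distribʳ-+ ℓ 27 (2 + 2 * c) ⟨
    (27 + (2 + 2 * c)) * ℓ    ∎
    where
    open ≤-Reasoning
    ℓ = 1 ⊔ ⌊log₂ ω ⌋
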